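{- For every $d\ge1$ and every $d$-regular graph $G$, if the edges of $G$ arrive in a uniformly random order, the greedy algorithm (which adds an arriving edge whenever the current set plus that edge is a matching) outputs a matching of expected size at least $\left(1-\frac1e\right)|\textsc{OPT}|$, where $\textsc{OPT}$ is a maximum matching of $G$. -}

module Defs where

open import Data.Bool.Base using (if_then_else_)
open import Data.Fin.Base as Fin using (Fin)
import Data.Fin.Properties as Fin
open import Data.Integer.Base as ℤ using (+_)
import Data.Integer.Properties as ℤ
open import Data.List.Base as List using (List; []; _∷_; filter; allFin; cartesianProduct)
open import Data.List.NonEmpty.Base as List⁺ using (List⁺; _∷_; _∷⁺_)
open import Data.List.Relation.Unary.All using (All; all?)
open import Data.List.Relation.Unary.AllPairs using (AllPairs; allPairs?)
open import Data.Nat.Base as ℕ using (ℕ; zero; suc; _!)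
open import Data.Nat.ListAction using (sum)
import Data.Nat.Properties as ℕ
open import Data.Product.Base using (∃; _×_; _,_; proj₁; proj₂)
open import Data.Rational.Base as ℚ
  using (ℚ; 0ℚ; 1ℚ; ½; Positive; NonNegative; _+_; _*_; _-_; -_; ∣_∣; _/_; 1/_; _≤_; toℚᵘ)
import Data.Rational.Properties as ℚ
open import Data.Rational.Solver using (module +-*-Solver)
open import Data.Rational.Unnormalised.Base as ℚᵘ using (mkℚᵘ; *≤*)
import Data.Rational.Unnormalised.Properties as ℚᵘ
open import Data.Sum.Base using (inj₁; inj₂)
open import Level using (0ℓ)
open import Relation.Binary.Core using (Rel)
open import Relation.Binary.Definitions using (Decidable; Irreflexive; Symmetric)
open import Relation.Binary.PropositionalEquality
open import Relation.Nullary.Decidable using (Dec; does; ¬?; _×-dec_)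

open +-*-Solver using (solve; _:+_; _:*_; _:-_; :-_; _:=_)

IsCauchy : (ℕ → ℚ) → Set
IsCauchy x = ∀ ε → Positive ε →
  ∃ λ N → ∀ m n → N ℕ.≤ m → N ℕ.≤ n → ∣ x m - x n ∣ ≤ ε

record ℝ : Set where
  constructor mkℝ
  field
    seq    : ℕ → ℚ
    cauchy : IsCauchy seq

open ℝ public

infix 4 _≤ℝ_

_≤ℝ_ : ℝ → ℝ → Set
x ≤ℝ y = ∀ ε → Positive ε → ∃ λ N → ∀ n → N ℕ.≤ n → seq x n ≤ seq y n + ε

Positiveℝ : ℝ → Set
Positiveℝ x = ∃ λ δ → Positive δ × ∃ λ N → ∀ n → N ℕ.≤ n → δ ≤ seq x n

private
  p-p : ∀ p → ∣ p - p ∣ ≡ 0ℚ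
  p-p p = cong ∣_∣ (ℚ.+-inverseʳ p)

  ⊔-lowerˡ : ∀ M N {k} → M ℕ.⊔ N ℕ.≤ k → M ℕ.≤ k
  ⊔-lowerˡ M N = ℕ.≤-trans (ℕ.m≤m⊔n M N)

  ⊔-lowerʳ : ∀ M N {k} → M ℕ.⊔ N ℕ.≤ k → N ℕ.≤ k
  ⊔-lowerʳ M N = ℕ.≤-trans (ℕ.m≤n⊔m M N)

  pos⇒0≤ : ∀ ε → Positive ε → 0ℚ ≤ ε
  pos⇒0≤ ε ε>0 = ℚ.<⇒≤ (ℚ.positive⁻¹ ε {{ε>0}})

  half-pos : ∀ ε → Positive ε → Positive (½ * ε)
  half-pos ε ε>0 = ℚ.pos*pos⇒pos ½ ε {{ε>0}}

  halves : ∀ ε → ½ * ε + ½ * ε ≡ ε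
  halves ε = trans (sym (ℚ.*-distribʳ-+ ε ½ ½)) (ℚ.*-identityˡ ε)

  ∣*∣-mono : ∀ {a b c d} → ∣ a ∣ ≤ c → ∣ b ∣ ≤ d → ∣ a * b ∣ ≤ c * d
  ∣*∣-mono {a} {b} {c} {d} a≤c b≤d = begin
    ∣ a * b ∣      ≡⟨ ℚ.∣p*q∣≡∣p∣*∣q∣ a b ⟩
    ∣ a ∣ * ∣ b ∣  ≤⟨ ℚ.*-monoʳ-≤-nonNeg ∣ b ∣ {{ℚ.∣-∣-nonNeg b}} a≤c ⟩
    c * ∣ b ∣      ≤⟨ ℚ.*-monoˡ-≤-nonNeg c {{ℚ.nonNegative (ℚ.≤-trans (ℚ.0≤∣p∣ a) a≤c)}} b≤d ⟩
    c * d          ∎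
    where open ℚ.≤-Reasoning

  ∣+∣-mono : ∀ {a b c d} → ∣ a ∣ ≤ c → ∣ b ∣ ≤ d → ∣ a + b ∣ ≤ c + d
  ∣+∣-mono {a} {b} a≤c b≤d = ℚ.≤-trans (ℚ.∣p+q∣≤∣p∣+∣q∣ a b) (ℚ.+-mono-≤ a≤c b≤d)

  bounded : ∀ (x : ℝ) → ∃ λ B → Positive B × ∃ λ N → ∀ n → N ℕ.≤ n → ∣ seq x n ∣ ≤ B
  bounded x with cauchy x 1ℚ _
  ... | N , close = B , B>0 , N , bound
    where
    B = 1ℚ + ∣ seq x N ∣
    B>0 : Positive B
    B>0 = ℚ.pos+nonNeg⇒pos 1ℚ ∣ seq x N ∣ {{ℚ.∣-∣-nonNeg (seq x N)}}
    split : ∀ a b → (a - b) + b ≡ a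
    split = solve 2 (λ a b → (a :- b) :+ b := a) refl
    bound : ∀ n → N ℕ.≤ n → ∣ seq x n ∣ ≤ B
    bound n N≤n = subst (λ z → ∣ z ∣ ≤ B) (split (seq x n) (seq x N))
      (∣+∣-mono {seq x n - seq x N} (close n N N≤n ℕ.≤-refl) (ℚ.≤-refl {∣ seq x N ∣}))

fromℚ : ℚ → ℝ
fromℚ p = mkℝ (λ _ → p) λ ε ε>0 → 0 , λ _ _ _ _ →
  ℚ.≤-trans (ℚ.≤-reflexive (p-p p)) (pos⇒0≤ ε ε>0)

fromℕ : ℕ → ℝ
fromℕ n = fromℚ (+ n / 1)

1ℝ : ℝ
1ℝ = fromℚ 1ℚ

infix  8 -ℝ_ 1/ℝ_
infixl 7 _*ℝ_
infixl 6 _+ℝ_ _-ℝ_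

_+ℝ_ : ℝ → ℝ → ℝ
x +ℝ y = mkℝ (λ n → seq x n + seq y n) c
  where
  regroup : ∀ a b a′ b′ → (a - a′) + (b - b′) ≡ (a + b) - (a′ + b′)
  regroup = solve 4 (λ a b a′ b′ → (a :- a′) :+ (b :- b′) := (a :+ b) :- (a′ :+ b′)) refl

  c : IsCauchy (λ n → seq x n + seq y n)
  c ε ε>0 with cauchy x (½ * ε) (half-pos ε ε>0) | cauchy y (½ * ε) (half-pos ε ε>0)
  ... | M , xM | N , yN = M ℕ.⊔ N , λ m n m≥ n≥ →
    subst₂ (λ a b → ∣ a ∣ ≤ b) (regroup (seq x m) (seq y m) (seq x n) (seq y n)) (halves ε)
      (∣+∣-mono {seq x m - seq x n}
        (xM m n (⊔-lowerˡ M N m≥) (⊔-lowerˡ M N n≥))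
        (yN m n (⊔-lowerʳ M N m≥) (⊔-lowerʳ M N n≥)))

-ℝ_ : ℝ → ℝ
-ℝ x = mkℝ (λ n → - seq x n) λ ε ε>0 → let N , close = cauchy x ε ε>0 in
  N , λ m n m≥ n≥ → subst (_≤ ε)
    (trans (sym (ℚ.∣-p∣≡∣p∣ (seq x m - seq x n))) (cong ∣_∣ (neg-sub (seq x m) (seq x n))))
    (close m n m≥ n≥)
  where
  neg-sub : ∀ a b → - (a - b) ≡ (- a) - (- b)
  neg-sub = solve 2 (λ a b → :- (a :- b) := (:- a) :- (:- b)) refl

_-ℝ_ : ℝ → ℝ → ℝ
x -ℝ y = x +ℝ (-ℝ y)

private
  scale : ∀ C ε → Positive C → Positive ε → ∃ λ δ → Positive δ × C * δ ≡ ε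
  scale C ε C>0 ε>0 =
      r * ε
    , ℚ.pos*pos⇒pos r {{ℚ.1/pos⇒pos C {{C>0}}}} ε {{ε>0}}
    , trans (sym (ℚ.*-assoc C r ε))
        (trans (cong (_* ε) (ℚ.*-inverseʳ C {{C≢0}})) (ℚ.*-identityˡ ε))
    where
    C≢0 = ℚ.pos⇒nonZero C {{C>0}}
    r = (1/ C) {{C≢0}}

  *-diff : ∀ a b a′ b′ → a * (b - b′) + b′ * (a - a′) ≡ a * b - a′ * b′
  *-diff = solve 4 (λ a b a′ b′ → a :* (b :- b′) :+ b′ :* (a :- a′) := a :* b :- a′ :* b′) refl

  *-close : ∀ a b a′ b′ {A B δ} → ∣ a ∣ ≤ A → ∣ b′ ∣ ≤ B → ∣ a - a′ ∣ ≤ δ → ∣ b - b′ ∣ ≤ δ →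
            ∣ a * b - a′ * b′ ∣ ≤ (A + B) * δ
  *-close a b a′ b′ {A} {B} {δ} a≤A b′≤B a-a′≤δ b-b′≤δ = begin
    ∣ a * b - a′ * b′ ∣                ≡⟨ cong ∣_∣ (*-diff a b a′ b′) ⟨
    ∣ a * (b - b′) + b′ * (a - a′) ∣
      ≤⟨ ∣+∣-mono {a * (b - b′)} {b′ * (a - a′)}
           (∣*∣-mono {a} {b - b′} a≤A b-b′≤δ) (∣*∣-mono {b′} {a - a′} b′≤B a-a′≤δ) ⟩
    A * δ + B * δ                      ≡⟨ ℚ.*-distribʳ-+ δ A B ⟨
    (A + B) * δ                        ∎
    where open ℚ.≤-Reasoning

  *-cauchy : ∀ x y → IsCauchy (λ n → seq x n * seq y n)
  *-cauchy x y ε ε>0 =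
    let A , A>0 , M , xM = bounded x
        B , B>0 , N , yN = bounded y
        δ , δ>0 , eq     = scale (A + B) ε (ℚ.pos+pos⇒pos A {{A>0}} B {{B>0}}) ε>0
        M′ , xM′         = cauchy x δ δ>0
        N′ , yN′         = cauchy y δ δ>0
        M≤  = λ {k} → ⊔-lowerˡ M N {k}
        N≤  = λ {k} → ⊔-lowerʳ M N {k}
        M′≤ = λ {k} → ⊔-lowerˡ M′ N′ {k}
        N′≤ = λ {k} → ⊔-lowerʳ M′ N′ {k}
        l≤  = λ {k} → ⊔-lowerˡ (M ℕ.⊔ N) (M′ ℕ.⊔ N′) {k}
        r≤  = λ {k} → ⊔-lowerʳ (M ℕ.⊔ N) (M′ ℕ.⊔ N′) {k}
    in (M ℕ.⊔ N) ℕ.⊔ (M′ ℕ.⊔ N′) , λ m n m≥ n≥ →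
       subst (∣ seq x m * seq y m - seq x n * seq y n ∣ ≤_) eq
         (*-close (seq x m) (seq y m) (seq x n) (seq y n)
           (xM m (M≤ (l≤ m≥))) (yN n (N≤ (l≤ n≥)))
           (xM′ m n (M′≤ (r≤ m≥)) (M′≤ (r≤ n≥))) (yN′ m n (N′≤ (r≤ m≥)) (N′≤ (r≤ n≥))))

_*ℝ_ : ℝ → ℝ → ℝ
x *ℝ y = mkℝ (λ n → seq x n * seq y n) (*-cauchy x y)

-- The terms below the index N of the positivity witness may vanish, so the
-- sequence is shifted by N before it is inverted.
1/ℝ_ : (x : ℝ) → {{Positiveℝ x}} → ℝ
1/ℝ_ x {{δ , δ>0 , N , x≥δ}} = mkℝ inv c
  where
  x′ : ℕ → ℚ
  x′ n = seq x (N ℕ.+ n)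

  δ≤x′ : ∀ n → δ ≤ x′ n
  δ≤x′ n = x≥δ (N ℕ.+ n) (ℕ.m≤m+n N n)

  x′>0 : ∀ n → Positive (x′ n)
  x′>0 n = ℚ.positive (ℚ.<-≤-trans (ℚ.positive⁻¹ δ {{δ>0}}) (δ≤x′ n))

  inv : ℕ → ℚ
  inv n = (1/ x′ n) {{ℚ.pos⇒nonZero (x′ n) {{x′>0 n}}}}

  inv>0 : ∀ n → Positive (inv n)
  inv>0 n = ℚ.1/pos⇒pos (x′ n) {{x′>0 n}}

  x′*inv : ∀ n → x′ n * inv n ≡ 1ℚ
  x′*inv n = ℚ.*-inverseʳ (x′ n) {{ℚ.pos⇒nonZero (x′ n) {{x′>0 n}}}}

  r : ℚ
  r = (1/ δ) {{ℚ.pos⇒nonZero δ {{δ>0}}}}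

  δ*r : δ * r ≡ 1ℚ
  δ*r = ℚ.*-inverseʳ δ {{ℚ.pos⇒nonZero δ {{δ>0}}}}

  inv≤r : ∀ n → ∣ inv n ∣ ≤ r
  inv≤r n = ℚ.≤-trans (ℚ.≤-reflexive (ℚ.0≤p⇒∣p∣≡p (pos⇒0≤ (inv n) (inv>0 n))))
    (ℚ.*-cancelˡ-≤-pos δ {{δ>0}} (begin
      δ * inv n     ≤⟨ ℚ.*-monoʳ-≤-nonNeg (inv n) {{ℚ.pos⇒nonNeg (inv n) {{inv>0 n}}}} (δ≤x′ n) ⟩
      x′ n * inv n  ≡⟨ x′*inv n ⟩
      1ℚ            ≡⟨ δ*r ⟨
      δ * r         ∎))
    where open ℚ.≤-Reasoning

  c : IsCauchy inv
  c ε ε>0 with cauchy x (ε * (δ * δ))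
    (ℚ.pos*pos⇒pos ε {{ε>0}} (δ * δ) {{ℚ.pos*pos⇒pos δ {{δ>0}} δ {{δ>0}}}})
  ... | K , close = K , λ m n m≥ n≥ → subst₂ (λ a b → ∣ a ∣ ≤ b) (diff m n) total
    (∣*∣-mono {x′ n - x′ m}
      (close (N ℕ.+ n) (N ℕ.+ m) (ℕ.≤-trans n≥ (ℕ.m≤n+m n N)) (ℕ.≤-trans m≥ (ℕ.m≤n+m m N)))
      (∣*∣-mono {inv m} (inv≤r m) (inv≤r n)))
    where
    open ≡-Reasoning

    diff : ∀ m n → (x′ n - x′ m) * (inv m * inv n) ≡ inv m - inv n
    diff m n = begin
      (x′ n - x′ m) * (inv m * inv n)
        ≡⟨ solve 4 (λ a b i j → (a :- b) :* (i :* j) := i :* (a :* j) :- j :* (b :* i)) refl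
             (x′ n) (x′ m) (inv m) (inv n) ⟩
      inv m * (x′ n * inv n) - inv n * (x′ m * inv m)
        ≡⟨ cong₂ (λ p q → inv m * p - inv n * q) (x′*inv n) (x′*inv m) ⟩
      inv m * 1ℚ - inv n * 1ℚ
        ≡⟨ cong₂ _-_ (ℚ.*-identityʳ (inv m)) (ℚ.*-identityʳ (inv n)) ⟩
      inv m - inv n ∎

    total : (ε * (δ * δ)) * (r * r) ≡ ε
    total = begin
      (ε * (δ * δ)) * (r * r)
        ≡⟨ solve 3 (λ ε δ r → (ε :* (δ :* δ)) :* (r :* r) := ε :* ((δ :* r) :* (δ :* r))) refl ε δ r ⟩
      ε * ((δ * r) * (δ * r))  ≡⟨ cong (λ z → ε * (z * z)) δ*r ⟩
      ε * (1ℚ * 1ℚ)            ≡⟨ ℚ.*-identityʳ ε ⟩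
      ε                        ∎

invFact : ℕ → ℚ
invFact k = (+ 1 / (k !)) {{k ℕ.!≢0}}

e-seq : ℕ → ℚ
e-seq zero    = invFact 0
e-seq (suc n) = e-seq n + invFact (suc n)

private
  invFact-pos : ∀ n → Positive (invFact n)
  invFact-pos n = ℚ.normalize-pos 1 (n !) {{n ℕ.!≢0}}

  toℚᵘ-1/ : ∀ a .{{_ : ℕ.NonZero a}} → toℚᵘ (+ 1 / a) ℚᵘ.≃ (+ 1 ℚᵘ./ a)
  toℚᵘ-1/ (suc a) = ℚ.toℚᵘ-fromℚᵘ (mkℚᵘ (+ 1) a)

  1/-antimono : ∀ a b .{{_ : ℕ.NonZero a}} .{{_ : ℕ.NonZero b}} →
                b ℕ.≤ a → + 1 / a ≤ + 1 / b
  1/-antimono a@(suc _) b@(suc _) b≤a = ℚ.toℚᵘ-cancel-≤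
    (ℚᵘ.≤-respˡ-≃ (ℚᵘ.≃-sym (toℚᵘ-1/ a)) (ℚᵘ.≤-respʳ-≃ (ℚᵘ.≃-sym (toℚᵘ-1/ b))
      (*≤* (subst₂ ℤ._≤_ (sym (ℤ.*-identityˡ (+ b))) (sym (ℤ.*-identityˡ (+ a))) (ℤ.+≤+ b≤a)))))

  1/-double : ∀ a b .{{_ : ℕ.NonZero a}} .{{_ : ℕ.NonZero b}} →
              2 ℕ.* b ℕ.≤ a → + 1 / a + + 1 / a ≤ + 1 / b
  1/-double a@(suc _) b@(suc _) 2b≤a = ℚ.toℚᵘ-cancel-≤
    (ℚᵘ.≤-respˡ-≃ (ℚᵘ.≃-sym (ℚᵘ.≃-trans (ℚ.toℚᵘ-homo-+ (+ 1 / a) (+ 1 / a))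
                                         (ℚᵘ.+-cong (toℚᵘ-1/ a) (toℚᵘ-1/ a))))
      (ℚᵘ.≤-respʳ-≃ (ℚᵘ.≃-sym (toℚᵘ-1/ b)) (*≤* (ℤ.+≤+ (begin
        (1 ℕ.* a ℕ.+ 1 ℕ.* a) ℕ.* b  ≡⟨ cong (λ z → (z ℕ.+ z) ℕ.* b) (ℕ.*-identityˡ a) ⟩
        (a ℕ.+ a) ℕ.* b              ≡⟨ cong (λ z → (a ℕ.+ z) ℕ.* b) (ℕ.+-identityʳ a) ⟨
        (2 ℕ.* a) ℕ.* b              ≡⟨ cong (ℕ._* b) (ℕ.*-comm 2 a) ⟩
        (a ℕ.* 2) ℕ.* b              ≡⟨ ℕ.*-assoc a 2 b ⟩
        a ℕ.* (2 ℕ.* b)              ≤⟨ ℕ.*-monoʳ-≤ a 2b≤a ⟩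
        a ℕ.* a                      ≡⟨ ℕ.*-identityˡ (a ℕ.* a) ⟨
        1 ℕ.* (a ℕ.* a)              ∎)))))
    where open ℕ.≤-Reasoning

  archimedean : ∀ ε → Positive ε → ∃ λ N → + 1 / suc N ≤ ε
  archimedean ε@(ℚ.mkℚ ℤ.+[1+ k ] d _) _ = d , ℚ.toℚᵘ-cancel-≤
    (ℚᵘ.≤-respˡ-≃ (ℚᵘ.≃-sym (toℚᵘ-1/ (suc d)))
      (*≤* (ℤ.*-monoʳ-≤-nonNeg (+ suc d) {+ 1} {+ suc k} (ℤ.+≤+ (ℕ.s≤s ℕ.z≤n)))))

  n≤n! : ∀ n → n ℕ.≤ n !
  n≤n! zero    = ℕ.z≤n
  n≤n! (suc n) = ℕ.m≤m*n (suc n) (n !) {{n ℕ.!≢0}}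

  e-mono : ∀ n k → e-seq n ≤ e-seq (k ℕ.+ n)
  e-mono n zero    = ℚ.≤-refl
  e-mono n (suc k) = ℚ.≤-trans (e-mono n k)
    (subst (_≤ e-seq (suc k ℕ.+ n)) (ℚ.+-identityʳ (e-seq (k ℕ.+ n)))
      (ℚ.+-monoʳ-≤ (e-seq (k ℕ.+ n)) (pos⇒0≤ _ (invFact-pos (suc (k ℕ.+ n))))))

  -- For n ≥ 1 the upper estimate e-seq n + 1/n! is decreasing in n.
  e-upper : ∀ n k → let m = k ℕ.+ suc n in e-seq m + invFact m ≤ e-seq (suc n) + invFact (suc n)
  e-upper n zero    = ℚ.≤-refl
  e-upper n (suc k) = begin
    (e-seq m + invFact (suc m)) + invFact (suc m)  ≡⟨ ℚ.+-assoc (e-seq m) _ _ ⟩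
    e-seq m + (invFact (suc m) + invFact (suc m))
      ≤⟨ ℚ.+-monoʳ-≤ (e-seq m) (1/-double (suc m !) (m !) {{suc m ℕ.!≢0}} {{m ℕ.!≢0}}
           (ℕ.*-monoˡ-≤ (m !) (ℕ.s≤s (ℕ.≤-trans (ℕ.s≤s ℕ.z≤n) (ℕ.m≤n+m (suc n) k))))) ⟩
    e-seq m + invFact m                         ≤⟨ e-upper n k ⟩
    e-seq (suc n) + invFact (suc n)             ∎
    where
    m = k ℕ.+ suc n
    open ℚ.≤-Reasoning

  e-close : ∀ ε → Positive ε → ∃ λ N → ∀ n k → N ℕ.≤ n → ∣ e-seq (k ℕ.+ n) - e-seq n ∣ ≤ ε
  e-close ε ε>0 with archimedean ε ε>0
  ... | N , 1/N≤ε = suc N , close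
    where
    open ℚ.≤-Reasoning
    close : ∀ n k → suc N ℕ.≤ n → ∣ e-seq (k ℕ.+ n) - e-seq n ∣ ≤ ε
    close n@(suc n-1) k N≤n = begin
      ∣ e-seq m - e-seq n ∣          ≡⟨ ℚ.0≤p⇒∣p∣≡p 0≤diff ⟩
      e-seq m - e-seq n              ≤⟨ ℚ.+-monoˡ-≤ (- e-seq n) m≤ ⟩
      (e-seq n + invFact n) - e-seq n
        ≡⟨ solve 2 (λ a b → (a :+ b) :- a := b) refl (e-seq n) (invFact n) ⟩
      invFact n                         ≤⟨ 1/-antimono (n !) (suc N) {{n ℕ.!≢0}} (ℕ.≤-trans N≤n (n≤n! n)) ⟩
      + 1 / suc N                    ≤⟨ 1/N≤ε ⟩
      ε                              ∎
      where
      m = k ℕ.+ n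
      0≤diff : 0ℚ ≤ e-seq m - e-seq n
      0≤diff = subst (_≤ e-seq m - e-seq n) (ℚ.+-inverseʳ (e-seq n))
        (ℚ.+-monoˡ-≤ (- e-seq n) (e-mono n k))
      m≤ : e-seq m ≤ e-seq n + invFact n
      m≤ = ℚ.≤-trans (subst (_≤ e-seq m + invFact m) (ℚ.+-identityʳ (e-seq m))
        (ℚ.+-monoʳ-≤ (e-seq m) (pos⇒0≤ _ (invFact-pos m)))) (e-upper n-1 k)

  ∣-∣-sym : ∀ a b → ∣ a - b ∣ ≡ ∣ b - a ∣
  ∣-∣-sym a b = trans (sym (ℚ.∣-p∣≡∣p∣ (a - b)))
    (cong ∣_∣ (solve 2 (λ a b → :- (a :- b) := b :- a) refl a b))

  e-cauchy : IsCauchy e-seq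
  e-cauchy ε ε>0 with e-close ε ε>0
  ... | N , close = N , go
    where
    go : ∀ m n → N ℕ.≤ m → N ℕ.≤ n → ∣ e-seq m - e-seq n ∣ ≤ ε
    go m n m≥ n≥ with ℕ.≤-total n m
    ... | inj₁ n≤m = subst (λ z → ∣ e-seq z - e-seq n ∣ ≤ ε) (ℕ.m∸n+n≡m n≤m)
                       (close n (m ℕ.∸ n) n≥)
    ... | inj₂ m≤n = subst (_≤ ε) (∣-∣-sym (e-seq n) (e-seq m))
                       (subst (λ z → ∣ e-seq z - e-seq m ∣ ≤ ε) (ℕ.m∸n+n≡m m≤n)
                         (close m (n ℕ.∸ m) m≥))

e : ℝ
e = mkℝ e-seq e-cauchy

instance
  e-positive : Positiveℝ e
  e-positive = 1ℚ , _ , 0 , λ n _ → subst (λ z → 1ℚ ≤ e-seq z) (ℕ.+-identityʳ n) (e-mono 0 n)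

record Graph (n : ℕ) : Set₁ where
  field
    Adj        : Rel (Fin n) 0ℓ
    adj?       : Decidable Adj
    adj-sym    : Symmetric Adj
    adj-irrefl : Irreflexive _≡_ Adj

Disjoint : ∀ {n} → Rel (Fin n × Fin n) 0ℓ
Disjoint (u , v) (u′ , v′) = (u ≢ u′ × u ≢ v′) × (v ≢ u′ × v ≢ v′)

disjoint? : ∀ {n} → Decidable (Disjoint {n})
disjoint? (u , v) (u′ , v′) =
  (¬? (u Fin.≟ u′) ×-dec ¬? (u Fin.≟ v′)) ×-dec (¬? (v Fin.≟ u′) ×-dec ¬? (v Fin.≟ v′))

module _ {n} (G : Graph n) where
  open Graph G

  degree : Fin n → ℕ
  degree v = List.length (filter (adj? v) (allFin n))

  Regular : ℕ → Set
  Regular d = ∀ v → degree v ≡ d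

  -- An edge {u , v} is represented once, by the pair with u < v.
  IsEdge : Fin n × Fin n → Set
  IsEdge (u , v) = u Fin.< v × Adj u v

  isEdge? : ∀ f → Dec (IsEdge f)
  isEdge? (u , v) = (u Fin.<? v) ×-dec adj? u v

  edges : List (Fin n × Fin n)
  edges = filter isEdge? (cartesianProduct (allFin n) (allFin n))

  -- A set of edges is a list without repetitions; pairwise disjointness
  -- already excludes repetitions.
  IsMatching : List (Fin n × Fin n) → Set
  IsMatching M = All IsEdge M × AllPairs Disjoint M

  isMatching? : ∀ M → Dec (IsMatching M)
  isMatching? M = all? isEdge? M ×-dec allPairs? disjoint? M

  IsMaximumMatching : List (Fin n × Fin n) → Set
  IsMaximumMatching M =
    IsMatching M × (∀ M′ → IsMatching M′ → List.length M′ ℕ.≤ List.length M)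

  greedyStep : List (Fin n × Fin n) → Fin n × Fin n → List (Fin n × Fin n)
  greedyStep M f = if does (isMatching? (f ∷ M)) then f ∷ M else M

  greedy : List (Fin n × Fin n) → List (Fin n × Fin n)
  greedy = List.foldl greedyStep []

insertions : ∀ {A : Set} → A → List A → List⁺ (List A)
insertions x []       = List⁺.[ x ∷ [] ]
insertions x (y ∷ ys) = (x ∷ y ∷ ys) ∷⁺ List⁺.map (y ∷_) (insertions x ys)

-- All m! orderings of a list of length m, with one entry for each
-- permutation of positions.
permutations : ∀ {A : Set} → List A → List⁺ (List A)
permutations []       = List⁺.[ [] ]
permutations (x ∷ xs) = List⁺.concatMap (insertions x) (permutations xs)

𝔼 : ∀ {A : Set} → List⁺ A → (A → ℕ) → ℚ
𝔼 (x ∷ xs) f = + sum (List.map f (x ∷ xs)) / suc (List.length xs)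

expectedGreedySize : ∀ {n} → Graph n → ℚ
expectedGreedySize G = 𝔼 (permutations (edges G)) (λ π → List.length (greedy G π))

{-# OPTIONS --safe #-}

-- A vertex v stays unmatched with probability at most 1/e.  The next edge to arrive is uniform
-- among the remaining ones, which include all edges between vacant vertices.  If v has k vacant
-- neighbours, k of these edges match v, while at most k (d - 1) incidences of other edges cover
-- neighbours of v; so exp(c/d), where c counts the covered neighbours of v, is a supermartingale
-- as long as v is vacant, because exp(1/d) ≤ d/(d-1) and exp(2/d) ≤ (d+1)/(d-1) (an edge of a
-- triangle at v covers two neighbours at once).  If v is never matched, this quantity rises from
-- 1 to e.  Replacing exp by the N-th partial sum of its series, scaled to a natural number, keeps
-- both inequalities, and hence bounds the probability by the reciprocal of the partial sum of e.
module Submission where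

open import Defs
open import Data.Bool.Base using (if_then_else_)
open import Data.Fin.Base as Fin using (Fin; zero; suc)
import Data.Fin.Properties as Fin
import Data.Integer.Base as ℤ
import Data.Integer.Properties as ℤ
open import Data.List.Base
  using (List; []; _∷_; _++_; map; length; filter; concat; foldl; allFin; cartesianProduct)
import Data.List.NonEmpty.Base as List⁺
open List⁺ using (List⁺; toList)
open import Data.List.Properties
  using (map-++; map-∘; map-tabulate; length-tabulate)
open import Data.List.Membership.Propositional using (_∈_)
open import Data.List.Membership.Propositional.Properties using (∈-map⁻)
open import Data.List.Relation.Unary.All as All using (All; []; _∷_)
open import Data.List.Relation.Unary.All.Properties using (all-filter)
open import Data.List.Relation.Unary.AllPairs using ([]; _∷_)
open import Data.List.Relation.Unary.Any using (here; there)
open import Data.Nat.Base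
open import Data.Nat.ListAction using (sum)
open import Data.Nat.ListAction.Properties using (sum-++)
open import Data.Nat.Properties
open import Data.Nat.Tactic.RingSolver using (solve-∀)
open import Data.Product.Base using (_×_; _,_; proj₁; proj₂)
import Data.Rational.Base as ℚ
open ℚ using (ℚ)
import Data.Rational.Properties as ℚ
open import Data.Rational.Solver using (module +-*-Solver)
import Data.Rational.Unnormalised.Base as ℚᵘ
import Data.Rational.Unnormalised.Properties as ℚᵘ
open import Data.Sum.Base using (_⊎_; inj₁; inj₂)
open import Function.Base using (_∘_; id)
open import Relation.Binary.Definitions using (tri<; tri≈; tri>)
open import Relation.Binary.PropositionalEquality
open import Relation.Nullary.Decidable using (Dec; does; yes; no; ¬?; _×-dec_; dec-true; dec-false)
open import Relation.Nullary.Negation using (contradiction; ¬_)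

open +-*-Solver using (solve; _:+_; _:*_; _:-_; _:=_)

-- Finite sums over lists and 0-1 indicators.

private
  variable
    A B : Set

∑ : List A → (A → ℕ) → ℕ
∑ xs f = sum (map f xs)

infix 5 ∑
syntax ∑ xs (λ x → t) = ∑[ x ∈ xs ] t

∑-cong : ∀ {f g : A → ℕ} xs → (∀ x → f x ≡ g x) → ∑ xs f ≡ ∑ xs g
∑-cong []       f≗g = refl
∑-cong (x ∷ xs) f≗g = cong₂ _+_ (f≗g x) (∑-cong xs f≗g)

∑-mono : ∀ {f g : A → ℕ} xs → (∀ {x} → x ∈ xs → f x ≤ g x) → ∑ xs f ≤ ∑ xs g
∑-mono []       f≤g = z≤n
∑-mono (x ∷ xs) f≤g = +-mono-≤ (f≤g (here refl)) (∑-mono xs (f≤g ∘ there))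

∑-+ : ∀ (f g : A → ℕ) xs → ∑ xs (λ x → f x + g x) ≡ ∑ xs f + ∑ xs g
∑-+ f g []       = refl
∑-+ f g (x ∷ xs) rewrite ∑-+ f g xs = lemma (f x) (g x) (∑ xs f) (∑ xs g)
  where
  lemma : ∀ a b c d → a + b + (c + d) ≡ a + c + (b + d)
  lemma = solve-∀

∑-*ˡ : ∀ k (f : A → ℕ) xs → ∑ xs (λ x → k * f x) ≡ k * ∑ xs f
∑-*ˡ k f []       = sym (*-zeroʳ k)
∑-*ˡ k f (x ∷ xs) rewrite ∑-*ˡ k f xs = sym (*-distribˡ-+ k (f x) (∑ xs f))

∑-const : ∀ k (xs : List A) → ∑ xs (λ _ → k) ≡ length xs * k
∑-const k []       = refl
∑-const k (x ∷ xs) = cong (k +_) (∑-const k xs)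

∑-swap : ∀ (xs : List A) (ys : List B) (f : A → B → ℕ) →
         (∑[ x ∈ xs ] ∑[ y ∈ ys ] f x y) ≡ (∑[ y ∈ ys ] ∑[ x ∈ xs ] f x y)
∑-swap []       ys f = sym (trans (∑-const 0 ys) (*-zeroʳ (length ys)))
∑-swap (x ∷ xs) ys f =
  trans (cong (∑ ys (f x) +_) (∑-swap xs ys f)) (sym (∑-+ (f x) (λ y → ∑[ x ∈ xs ] f x y) ys))

∑-++ : ∀ (f : A → ℕ) xs ys → ∑ (xs ++ ys) f ≡ ∑ xs f + ∑ ys f
∑-++ f xs ys = trans (cong sum (map-++ f xs ys)) (sum-++ (map f xs) (map f ys))

∑-map : ∀ (f : B → ℕ) (h : A → B) xs → ∑ (map h xs) f ≡ ∑ xs (f ∘ h)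
∑-map f h xs = cong sum (sym (map-∘ xs))

⟦_⟧ : ∀ {P : Set} → Dec P → ℕ
⟦ p? ⟧ = if does p? then 1 else 0

⟦⟧-× : ∀ {P Q : Set} (p? : Dec P) (q? : Dec Q) → ⟦ p? ×-dec q? ⟧ ≡ ⟦ p? ⟧ * ⟦ q? ⟧
⟦⟧-× (yes _) (yes _) = refl
⟦⟧-× (yes _) (no _)  = refl
⟦⟧-× (no _)  _       = refl

0-or-1 : ∀ {P : Set} (p? : Dec P) → ⟦ p? ⟧ ≡ 0 ⊎ ⟦ p? ⟧ ≡ 1
0-or-1 (yes _) = inj₂ refl
0-or-1 (no _)  = inj₁ refl

*-0-or-1 : ∀ {x y} → x ≡ 0 ⊎ x ≡ 1 → y ≡ 0 ⊎ y ≡ 1 → x * y ≡ 0 ⊎ x * y ≡ 1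
*-0-or-1 (inj₁ refl) _           = inj₁ refl
*-0-or-1 (inj₂ refl) (inj₁ refl) = inj₁ refl
*-0-or-1 (inj₂ refl) (inj₂ refl) = inj₂ refl

∑-filter : ∀ {P : A → Set} (P? : ∀ x → Dec (P x)) f xs →
           ∑ (filter P? xs) f ≡ (∑[ x ∈ xs ] ⟦ P? x ⟧ * f x)
∑-filter P? f [] = refl
∑-filter P? f (x ∷ xs) with P? x
... | yes _ = cong₂ _+_ (sym (*-identityˡ (f x))) (∑-filter P? f xs)
... | no _  = ∑-filter P? f xs

∑-cartesianProduct : ∀ (f : A × B → ℕ) xs ys →
                     ∑ (cartesianProduct xs ys) f ≡ (∑[ x ∈ xs ] ∑[ y ∈ ys ] f (x , y))
∑-cartesianProduct f []       ys = refl
∑-cartesianProduct f (x ∷ xs) ys = trans (∑-++ f (map (x ,_) ys) (cartesianProduct xs ys))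
  (cong₂ _+_ (∑-map f (x ,_) ys) (∑-cartesianProduct f xs ys))

∑-allFin-suc : ∀ {n} (f : Fin (suc n) → ℕ) → ∑ (allFin (suc n)) f ≡ f zero + ∑ (allFin n) (f ∘ suc)
∑-allFin-suc {n} f = cong (λ l → f zero + sum l)
  (trans (map-tabulate suc f) (sym (map-tabulate id (f ∘ suc))))

∑-single : ∀ {n} (f : Fin n → ℕ) a → (∀ u → a ≢ u → f u ≡ 0) → ∑ (allFin n) f ≡ f a
∑-single {suc n} f zero    f≡0 = trans (∑-allFin-suc f) (trans (cong (f zero +_) zeros) (+-identityʳ (f zero)))
  where
  zeros : ∑ (allFin n) (f ∘ suc) ≡ 0
  zeros = trans (∑-cong (allFin n) (λ u → f≡0 (suc u) λ ()))
    (trans (∑-const 0 (allFin n)) (*-zeroʳ (length (allFin n))))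
∑-single {suc n} f (suc a) f≡0 = trans (∑-allFin-suc f)
  (cong₂ _+_ (f≡0 zero λ ()) (∑-single (f ∘ suc) a λ u a≢u → f≡0 (suc u) (a≢u ∘ Fin.suc-injective)))

-- Uniform orderings, drawn one element at a time.

perms : List A → List (List A)
perms xs = toList (permutations xs)

select : List A → List (A × List A)
select []       = []
select (x ∷ xs) = (x , xs) ∷ map (λ (y , ys) → y , x ∷ ys) (select xs)

∑-concatMap⁺ : ∀ (h : A → List⁺ B) (f : B → ℕ) xs →
               ∑ (toList (List⁺.concatMap h xs)) f ≡ (∑[ x ∈ toList xs ] ∑ (toList (h x)) f)
∑-concatMap⁺ h f (x List⁺.∷ xs) = trans (∑-++ f (toList (h x)) _) (cong (∑ (toList (h x)) f +_) (go xs))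
  where
  go : ∀ xs → ∑ (concat (map toList (map h xs))) f ≡ (∑[ x ∈ xs ] ∑ (toList (h x)) f)
  go []       = refl
  go (x ∷ xs) = trans (∑-++ f (toList (h x)) _) (cong (∑ (toList (h x)) f +_) (go xs))

-- Reads a uniform ordering as a draw without replacement: first element, then an ordering of the
-- rest. As `permutations` works by insertion, the orderings that begin with `x` are split off, and
-- the others are grouped by the element `y` in front before `x` is inserted behind it.
∑-perms : ∀ (x : A) xs f →
          ∑ (perms (x ∷ xs)) f ≡ (∑[ s ∈ select (x ∷ xs) ] ∑[ π ∈ perms (proj₂ s) ] f (proj₁ s ∷ π))
∑-perms x []           f = sym (+-identityʳ (f (x ∷ []) + 0))
∑-perms {A} x xs@(z ∷ zs) f = begin
  ∑ (perms (x ∷ xs)) f                                    ≡⟨ ∑-concatMap⁺ (insertions x) f (permutations xs) ⟩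
  (∑[ π ∈ perms xs ] ∑ (toList (insertions x π)) f)       ≡⟨ ∑-cong (perms xs) split ⟩
  (∑[ π ∈ perms xs ] f (x ∷ π) + later π)                 ≡⟨ ∑-+ (f ∘ (x ∷_)) later (perms xs) ⟩
  first + ∑ (perms xs) later                              ≡⟨ cong (first +_) (∑-perms z zs later) ⟩
  first + (∑[ s ∈ select xs ] ∑[ π ∈ perms (proj₂ s) ] later (proj₁ s ∷ π))
    ≡⟨ cong (first +_) (∑-cong (select xs) λ s →
         sym (∑-concatMap⁺ (insertions x) (f ∘ (proj₁ s ∷_)) (permutations (proj₂ s)))) ⟩
  first + (∑[ s ∈ select xs ] ∑[ π ∈ perms (x ∷ proj₂ s) ] f (proj₁ s ∷ π))
    ≡⟨ cong (first +_) (∑-map _ (λ (y , ys) → y , x ∷ ys) (select xs)) ⟨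
  first + (∑[ s ∈ map (λ (y , ys) → y , x ∷ ys) (select xs) ] ∑[ π ∈ perms (proj₂ s) ] f (proj₁ s ∷ π)) ∎
  where
  open ≡-Reasoning
  first = ∑[ π ∈ perms xs ] f (x ∷ π)
  later : List A → ℕ
  -- Exact, not a mere default: inserting `x` into the empty list gives only the list that begins
  -- with `x`.
  later []       = 0
  later (y ∷ ys) = ∑[ σ ∈ toList (insertions x ys) ] f (y ∷ σ)
  split : ∀ π → ∑ (toList (insertions x π)) f ≡ f (x ∷ π) + later π
  split []       = refl
  split (y ∷ ys) = cong (f (x ∷ y ∷ ys) +_) (∑-map f (y ∷_) (toList (insertions x ys)))

∑-select : ∀ (f : A → ℕ) xs → (∑[ s ∈ select xs ] f (proj₁ s)) ≡ ∑ xs f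
∑-select f []       = refl
∑-select f (x ∷ xs) = cong (f x +_) (trans (∑-map _ (λ (y , ys) → y , x ∷ ys) (select xs)) (∑-select f xs))

-- Arbitrary weights `f` express that removing the selected element leaves the rest as a multiset;
-- weight 1 gives lengths, and other weights give the invariants of the process.
select-split : ∀ {xs : List A} {s} → s ∈ select xs → ∀ f → ∑ xs f ≡ f (proj₁ s) + ∑ (proj₂ s) f
select-split {xs = x ∷ xs} (here refl) f = refl
select-split {xs = x ∷ xs} (there s∈) f with ∈-map⁻ _ s∈
... | (y , ys) , y∈ , refl = trans (cong (f x +_) (select-split y∈ f)) (lemma (f x) (f y) (∑ ys f))
  where
  lemma : ∀ a b c → a + (b + c) ≡ b + (a + c)
  lemma = solve-∀

select-length : ∀ {xs : List A} {s} → s ∈ select xs → length xs ≡ suc (length (proj₂ s))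
select-length {xs = xs} {s} s∈ = begin
  length xs                     ≡⟨ *-identityʳ (length xs) ⟨
  length xs * 1                 ≡⟨ ∑-const 1 xs ⟨
  ∑ xs (λ _ → 1)                ≡⟨ select-split s∈ (λ _ → 1) ⟩
  1 + ∑ (proj₂ s) (λ _ → 1)     ≡⟨ cong suc (trans (∑-const 1 (proj₂ s)) (*-identityʳ _)) ⟩
  suc (length (proj₂ s))        ∎
  where open ≡-Reasoning

select-All : ∀ {P : A → Set} {xs s} → s ∈ select xs → All P xs → P (proj₁ s) × All P (proj₂ s)
select-All (here refl) (px ∷ pxs) = px , pxs
select-All (there s∈) (px ∷ pxs) with ∈-map⁻ _ s∈
... | s , s∈′ , refl with select-All s∈′ pxs
...   | py , pys = py , px ∷ pys

length-perms : ∀ r (xs : List A) → length xs ≡ r → length (perms xs) ≡ r !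
length-perms zero    []           _  = refl
length-perms (suc r) xs@(x ∷ xs′) eq = begin
  length (perms xs)                                  ≡⟨ *-identityʳ _ ⟨
  length (perms xs) * 1                              ≡⟨ ∑-const 1 (perms xs) ⟨
  ∑ (perms xs) (λ _ → 1)                             ≡⟨ ∑-perms x xs′ (λ _ → 1) ⟩
  -- The equality `rest` holds only for members of `select xs`, so it is summed as two inequalities
  -- with `∑-mono`.
  (∑[ s ∈ select xs ] ∑ (perms (proj₂ s)) (λ _ → 1)) ≡⟨ ≤-antisym (∑-mono (select xs) (≤-reflexive ∘ rest))
                                                          (∑-mono (select xs) (≤-reflexive ∘ sym ∘ rest)) ⟩
  ∑ (select xs) (λ _ → r !)                          ≡⟨ ∑-select (λ _ → r !) xs ⟩
  ∑ xs (λ _ → r !)                                   ≡⟨ ∑-const (r !) xs ⟩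
  length xs * r !                                    ≡⟨ cong (_* r !) eq ⟩
  suc r * r !                                        ∎
  where
  open ≡-Reasoning
  rest : ∀ {s} → s ∈ select xs → ∑ (perms (proj₂ s)) (λ _ → 1) ≡ r !
  rest {s} s∈ = trans (∑-const 1 (perms (proj₂ s))) (trans (*-identityʳ _)
    (length-perms r (proj₂ s) (suc-injective (trans (sym (select-length s∈)) eq))))

-- Truncated exponential series with denominators cleared.

-- dᴺ N! Σ_{i ≤ N} (c/d)ⁱ / i!
expWeight : ℕ → ℕ → ℕ → ℕ
expWeight d zero    c = 1
expWeight d (suc N) c = suc N * d * expWeight d N c + c ^ suc N

-- N! Σ_{i ≤ N} 1 / i!
expNumerator : ℕ → ℕ
expNumerator N = expWeight 1 N 1

-- The right endpoint overestimates the integral of (k+1) xᵏ from a to a + 1, as xᵏ is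
-- nondecreasing.
^-step₁ : ∀ k a → suc a ^ suc k ≤ a ^ suc k + suc k * suc a ^ k
^-step₁ zero    a = ≤-reflexive (lemma a)
  where
  lemma : ∀ a → suc a * 1 ≡ a * 1 + 1 * 1
  lemma = solve-∀
^-step₁ (suc k) a = begin
  suc a * (suc a ^ suc k)                           ≤⟨ +-monoʳ-≤ (suc a ^ suc k) (*-monoʳ-≤ a (^-step₁ k a)) ⟩
  suc a * bᵏ + a * (a * aᵏ + suc k * bᵏ)               ≡⟨ lemma₁ a k aᵏ bᵏ ⟩
  a * (a * aᵏ) + suc k * (a * bᵏ) + suc a * bᵏ
    ≤⟨ +-monoˡ-≤ (suc a * bᵏ) (+-monoʳ-≤ (a * (a * aᵏ)) (*-monoʳ-≤ (suc k) (*-monoˡ-≤ bᵏ (n≤1+n a)))) ⟩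
  a * (a * aᵏ) + suc k * (suc a * bᵏ) + suc a * bᵏ     ≡⟨ lemma₂ (a * (a * aᵏ)) k (suc a * bᵏ) ⟩
  a * (a * aᵏ) + suc (suc k) * (suc a * bᵏ)           ∎
  where
  open ≤-Reasoning
  aᵏ = a ^ k
  bᵏ = suc a ^ k
  lemma₁ : ∀ a k aᵏ bᵏ → suc a * bᵏ + a * (a * aᵏ + suc k * bᵏ) ≡ a * (a * aᵏ) + suc k * (a * bᵏ) + suc a * bᵏ
  lemma₁ = solve-∀
  lemma₂ : ∀ x k y → x + suc k * y + y ≡ x + suc (suc k) * y
  lemma₂ = solve-∀

-- The trapezoid rule overestimates ∫ xᵏ dx from a to a + 2, as xᵏ is convex.
^-step₂ : ∀ k a → (2 + a) ^ suc k ≤ a ^ suc k + suc k * (a ^ k + (2 + a) ^ k)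
^-step₂ zero    a = ≤-reflexive (lemma a)
  where
  lemma : ∀ a → (2 + a) * 1 ≡ a * 1 + 1 * (1 + 1)
  lemma = solve-∀
^-step₂ (suc k) a = begin
  b * (b * bᵏ)                                       ≡⟨ lemma₁ a bᵏ ⟩
  suc a * (b * bᵏ) + b * bᵏ                           ≤⟨ +-monoˡ-≤ (b * bᵏ) (*-monoʳ-≤ (suc a) (^-step₂ k a)) ⟩
  suc a * (a * aᵏ + suc k * (aᵏ + bᵏ)) + b * bᵏ         ≡⟨ lemma₂ a k aᵏ bᵏ ⟩
  a * (a * aᵏ) + (a * aᵏ + b * bᵏ) + suc k * (a * aᵏ + (suc a * bᵏ + aᵏ))
    -- Raising the lone `aᵏ` to `bᵏ` completes `suc a * bᵏ` to `b * bᵏ`.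
    ≤⟨ +-monoʳ-≤ (a * (a * aᵏ) + (a * aᵏ + b * bᵏ)) (*-monoʳ-≤ (suc k) (+-monoʳ-≤ (a * aᵏ)
         (+-monoʳ-≤ (suc a * bᵏ) (^-monoˡ-≤ k (m≤n+m a 2))))) ⟩
  a * (a * aᵏ) + (a * aᵏ + b * bᵏ) + suc k * (a * aᵏ + (suc a * bᵏ + bᵏ)) ≡⟨ lemma₃ a k aᵏ bᵏ ⟩
  a * (a * aᵏ) + suc (suc k) * (a * aᵏ + b * bᵏ)       ∎
  where
  open ≤-Reasoning
  b = 2 + a
  aᵏ = a ^ k
  bᵏ = b ^ k
  lemma₁ : ∀ a bᵏ → (2 + a) * ((2 + a) * bᵏ) ≡ suc a * ((2 + a) * bᵏ) + (2 + a) * bᵏ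
  lemma₁ = solve-∀
  lemma₂ : ∀ a k aᵏ bᵏ → suc a * (a * aᵏ + suc k * (aᵏ + bᵏ)) + (2 + a) * bᵏ ≡
                       a * (a * aᵏ) + (a * aᵏ + (2 + a) * bᵏ) + suc k * (a * aᵏ + (suc a * bᵏ + aᵏ))
  lemma₂ = solve-∀
  lemma₃ : ∀ a k aᵏ bᵏ → a * (a * aᵏ) + (a * aᵏ + (2 + a) * bᵏ) + suc k * (a * aᵏ + (suc a * bᵏ + bᵏ)) ≡
                       a * (a * aᵏ) + suc (suc k) * (a * aᵏ + (2 + a) * bᵏ)
  lemma₃ = solve-∀

module _ (d : ℕ) where

  private
    w = expWeight d

  -- As a function of c, `w (suc N)` has derivative `suc N * w N`. Its increase over a unit interval
  -- is bounded by the derivative at the right end, with `^-step₁` handling the top power.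
  expWeight-diff₁ : ∀ N c → w (suc N) (suc c) ≤ w (suc N) c + suc N * w N (suc c)
  expWeight-diff₁ zero c = ≤-reflexive (lemma d c)
    where
    lemma : ∀ d c → 1 * d * 1 + suc c * 1 ≡ 1 * d * 1 + c * 1 + 1 * 1
    lemma = solve-∀
  expWeight-diff₁ (suc N) c = begin
    k * d * w (suc N) (suc c) + suc c ^ k
      ≤⟨ +-mono-≤ (*-monoʳ-≤ (k * d) (expWeight-diff₁ N c)) (^-step₁ (suc N) c) ⟩
    k * d * (w (suc N) c + suc N * w N (suc c)) + (c ^ k + k * suc c ^ suc N)
      ≡⟨ lemma k d (suc N) (w (suc N) c) (w N (suc c)) (c ^ k) (suc c ^ suc N) ⟩
    (k * d * w (suc N) c + c ^ k) + k * (suc N * d * w N (suc c) + suc c ^ suc N) ∎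
    where
    open ≤-Reasoning
    k = suc (suc N)
    lemma : ∀ k d m x y p q → k * d * (x + m * y) + (p + k * q) ≡ k * d * x + p + k * (m * d * y + q)
    lemma = solve-∀

  -- The trapezoid estimate for the same derivative over an interval of length 2, with `^-step₂`
  -- handling the top power.
  expWeight-diff₂ : ∀ N c → w (suc N) (2 + c) ≤ w (suc N) c + suc N * (w N c + w N (2 + c))
  expWeight-diff₂ zero c = ≤-reflexive (lemma d c)
    where
    lemma : ∀ d c → 1 * d * 1 + (2 + c) * 1 ≡ 1 * d * 1 + c * 1 + 1 * (1 + 1)
    lemma = solve-∀
  expWeight-diff₂ (suc N) c = begin
    k * d * w (suc N) (2 + c) + (2 + c) ^ k
      ≤⟨ +-mono-≤ (*-monoʳ-≤ (k * d) (expWeight-diff₂ N c)) (^-step₂ (suc N) c) ⟩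
    k * d * (w (suc N) c + suc N * (w N c + w N (2 + c))) + (c ^ k + k * (c ^ suc N + (2 + c) ^ suc N))
      ≡⟨ lemma k d (suc N) (w (suc N) c) (w N c) (w N (2 + c)) (c ^ k) (c ^ suc N) ((2 + c) ^ suc N) ⟩
    (k * d * w (suc N) c + c ^ k) +
      k * ((suc N * d * w N c + c ^ suc N) + (suc N * d * w N (2 + c) + (2 + c) ^ suc N)) ∎
    where
    open ≤-Reasoning
    k = suc (suc N)
    lemma : ∀ k d m x y z p q r → k * d * (x + m * (y + z)) + (p + k * (q + r)) ≡
                                  k * d * x + p + k * (m * d * y + q + (m * d * z + r))
    lemma = solve-∀

  -- Differentiating the truncated exp(c/d) and multiplying by d loses only the top term of the
  -- series.
  expWeight-suc : ∀ N c → d * (suc N * w N c) ≤ w (suc N) c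
  expWeight-suc N c = ≤-trans (≤-reflexive (lemma d (suc N) (w N c))) (m≤m+n _ _)
    where
    lemma : ∀ d m x → d * (m * x) ≡ m * d * x
    lemma = solve-∀

  -- The inequality exp(1/d) ≤ d/(d-1) for truncated series, written additively so that d - 1 does
  -- not occur.
  expWeight-step₁ : ∀ N c → d * w N (suc c) ≤ d * w N c + w N (suc c)
  expWeight-step₁ zero    c = m≤m+n (d * 1) 1
  expWeight-step₁ (suc N) c = begin
    d * w (suc N) (suc c)                            ≤⟨ *-monoʳ-≤ d (expWeight-diff₁ N c) ⟩
    d * (w (suc N) c + suc N * w N (suc c))          ≡⟨ *-distribˡ-+ d (w (suc N) c) _ ⟩
    d * w (suc N) c + d * (suc N * w N (suc c))      ≤⟨ +-monoʳ-≤ (d * w (suc N) c) (expWeight-suc N (suc c)) ⟩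
    d * w (suc N) c + w (suc N) (suc c)              ∎
    where open ≤-Reasoning

  -- Likewise exp(2/d) ≤ (d+1)/(d-1). The right endpoint alone would give only d/(d-2), hence the
  -- trapezoid rule.
  expWeight-step₂ : ∀ N c → d * w N (2 + c) ≤ d * w N c + (w N c + w N (2 + c))
  expWeight-step₂ zero    c = m≤m+n (d * 1) 2
  expWeight-step₂ (suc N) c = begin
    d * w (suc N) (2 + c)                                              ≤⟨ *-monoʳ-≤ d (expWeight-diff₂ N c) ⟩
    d * (w (suc N) c + suc N * (w N c + w N (2 + c)))                  ≡⟨ lemma d (w (suc N) c) (suc N) _ _ ⟩
    d * w (suc N) c + (d * (suc N * w N c) + d * (suc N * w N (2 + c)))
      ≤⟨ +-monoʳ-≤ (d * w (suc N) c) (+-mono-≤ (expWeight-suc N c) (expWeight-suc N (2 + c))) ⟩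
    d * w (suc N) c + (w (suc N) c + w (suc N) (2 + c))                ∎
    where
    open ≤-Reasoning
    lemma : ∀ d x m y z → d * (x + m * (y + z)) ≡ d * x + (d * (m * y) + d * (m * z))
    lemma = solve-∀

  expWeight-0 : ∀ N → w N 0 ≡ d ^ N * N !
  expWeight-0 zero    = refl
  expWeight-0 (suc N) rewrite expWeight-0 N = lemma (suc N) d (d ^ N) (N !)
    where
    lemma : ∀ m d x y → m * d * (x * y) + 0 ≡ d * x * (m * y)
    lemma = solve-∀

  expWeight-d : ∀ N → w N d ≡ d ^ N * expNumerator N
  expWeight-d zero    = refl
  expWeight-d (suc N) rewrite expWeight-d N | ^-zeroˡ N = lemma (suc N) d (d ^ N) (expNumerator N)
    where
    lemma : ∀ m d x y → m * d * (x * y) + d * x ≡ d * x * (m * 1 * y + 1)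
    lemma = solve-∀

-- Potential functions of the number of covered neighbours.

-- w c bounds, up to scaling, the probability that a vertex of degree suc d′ with c covered
-- neighbours remains unmatched.
record Potential (d′ N : ℕ) : Set where
  field
    w       : ℕ → ℕ
    p q     : ℕ
    {{q≢0}} : NonZero q
    {{w₀≢0}} : NonZero (w 0)
    ratio   : p * d′ ≤ q
    step₁   : ∀ c → q * w (1 + c) ≤ (q + p) * w c
    step₂   : ∀ c → q * w (2 + c) ≤ (q + 2 * p) * w c
    growth  : expNumerator N * w 0 ≤ N ! * w (suc d′)

-- With d = d′ + 1, the growth factors d/(d-1) and (d+1)/(d-1) of the truncated exponential are
-- (q+p)/q and (q+2p)/q for q = d′, p = 1. At d′ = 0 these denominators vanish, and a geometric
-- potential with growth `X` from 0 to 1 takes its place.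
potential : ∀ d′ N → Potential d′ N
potential zero N = record
  { w = X ^_ ; p = X * X ; q = 1  -- any sufficiently large p, as ratio is vacuous for d′ = 0
  ; ratio = ≤-trans (≤-reflexive (*-zeroʳ (X * X))) z≤n
  ; step₁ = λ c → ≤-trans (≤-reflexive (*-identityˡ (X * X ^ c))) (*-monoˡ-≤ (X ^ c) (X≤1+X² X))
  ; step₂ = λ c → ≤-trans (≤-reflexive (lemma X (X ^ c))) (*-monoˡ-≤ (X ^ c)
      (≤-trans (m≤m+n (X * X) (X * X + 0)) (n≤1+n _)))
  ; growth = ≤-trans (≤-reflexive (trans (*-comm X 1) (cong (1 *_) (sym (*-identityʳ X)))))
      (*-monoˡ-≤ (X * 1) (1≤n! N))
  }
  where
  X = expNumerator N
  X≤1+X² : ∀ x → x ≤ 1 + x * x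
  X≤1+X² zero    = z≤n
  X≤1+X² (suc x) = ≤-trans (m≤m*n (suc x) (suc x)) (n≤1+n _)
  lemma : ∀ x y → 1 * (x * (x * y)) ≡ x * x * y
  lemma = solve-∀
potential q@(suc _) N = record
  { w = w ; p = 1 ; q = q
  ; w₀≢0 = subst NonZero (sym (expWeight-0 (suc q) N))
      (m*n≢0 (suc q ^ N) (N !) {{m^n≢0 (suc q) N}} {{N !≢0}})
  ; ratio = ≤-reflexive (*-identityˡ q)
  -- Cancelling one copy of `w (1 + c)` lowers its factor from d to d - 1 = q.
  ; step₁ = λ c → +-cancelˡ-≤ (w (1 + c)) _ _ (≤-trans (expWeight-step₁ (suc q) N c)
      (≤-reflexive (lemma₁ q (w c) (w (1 + c)))))
  ; step₂ = λ c → +-cancelˡ-≤ (w (2 + c)) _ _ (≤-trans (expWeight-step₂ (suc q) N c)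
      (≤-reflexive (lemma₂ q (w c) (w (2 + c)))))
  ; growth = ≤-reflexive (trans (cong (expNumerator N *_) (expWeight-0 (suc q) N))
      (trans (lemma₃ (expNumerator N) (suc q ^ N) (N !)) (cong (N ! *_) (sym (expWeight-d (suc q) N)))))
  }
  where
  w = expWeight (suc q) N
  lemma₁ : ∀ q x y → suc q * x + y ≡ y + (q + 1) * x
  lemma₁ = solve-∀
  lemma₂ : ∀ q x y → suc q * x + (x + y) ≡ y + (q + 2 * 1) * x
  lemma₂ = solve-∀
  lemma₃ : ∀ x y z → x * (y * z) ≡ z * (y * x)
  lemma₃ = solve-∀

-- Counting on a fixed graph.

if-elim : ∀ {P : Set} (Q : A → Set) (p? : Dec P) {x y} →
          (P → Q x) → Q y → Q (if does p? then x else y)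
if-elim Q (yes p) f qy = f p
if-elim Q (no _)  f qy = qy

module _ {n} (G : Graph n) where
  open Graph G

  private
    V : List (Fin n)
    V = allFin n

    Edge : Set
    Edge = Fin n × Fin n

  eq ne adj : Fin n → Fin n → ℕ
  eq a u  = ⟦ a Fin.≟ u ⟧
  ne a u  = ⟦ ¬? (a Fin.≟ u) ⟧
  adj a b = ⟦ adj? a b ⟧

  eq-refl : ∀ a → eq a a ≡ 1
  eq-refl a rewrite dec-true (a Fin.≟ a) refl = refl

  ne-refl : ∀ a → ne a a ≡ 0
  ne-refl a rewrite dec-true (a Fin.≟ a) refl = refl

  eq-≢ : ∀ {a u} → a ≢ u → eq a u ≡ 0
  eq-≢ {a} {u} a≢u rewrite dec-false (a Fin.≟ u) a≢u = refl

  ne-≢ : ∀ {a u} → a ≢ u → ne a u ≡ 1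
  ne-≢ {a} {u} a≢u rewrite dec-false (a Fin.≟ u) a≢u = refl

  ne≡1⇒≢ : ∀ {a u} → ne a u ≡ 1 → a ≢ u
  ne≡1⇒≢ {a} ne≡1 refl with trans (sym (ne-refl a)) ne≡1
  ... | ()

  ne+eq : ∀ a u → ne a u + eq a u ≡ 1
  ne+eq a u with a Fin.≟ u
  ... | yes _ = refl
  ... | no _  = refl

  adj-comm : ∀ a b → adj a b ≡ adj b a
  adj-comm a b with adj? a b | adj? b a
  ... | yes _  | yes _  = refl
  ... | yes ab | no ¬ba = contradiction (adj-sym ab) ¬ba
  ... | no ¬ab | yes ba = contradiction (adj-sym ba) ¬ab
  ... | no _   | no _   = refl

  ∑-eq : ∀ a (f : Fin n → ℕ) → (∑[ u ∈ V ] eq a u * f u) ≡ f a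
  ∑-eq a f = trans (∑-single (λ u → eq a u * f u) a λ u a≢u → cong (_* f u) (eq-≢ a≢u))
    (trans (cong (_* f a) (eq-refl a)) (*-identityˡ (f a)))

  ∑-adj : ∀ v → ∑ V (adj v) ≡ degree G v
  ∑-adj v = begin
    ∑ V (adj v)                               ≡⟨ ∑-cong V (λ u → *-identityʳ (adj v u)) ⟨
    (∑[ u ∈ V ] adj v u * 1)                  ≡⟨ ∑-filter (adj? v) (λ _ → 1) V ⟨
    ∑ (filter (adj? v) V) (λ _ → 1)           ≡⟨ ∑-const 1 (filter (adj? v) V) ⟩
    degree G v * 1                            ≡⟨ *-identityʳ (degree G v) ⟩
    degree G v                                ∎
    where open ≡-Reasoning

  -- The list `edges G` holds each edge in one orientation, while the double sum over adjacent pairs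
  -- meets both; symmetrising the weight removes the difference.
  ∑-edges : ∀ (s : Fin n → Fin n → ℕ) →
            (∑[ e ∈ edges G ] s (proj₁ e) (proj₂ e) + s (proj₂ e) (proj₁ e)) ≡
            (∑[ a ∈ V ] ∑[ b ∈ V ] adj a b * s a b)
  ∑-edges s = begin
    ∑ (edges G) (λ (a , b) → s a b + s b a)
      ≡⟨ ∑-filter (isEdge? G) _ (cartesianProduct V V) ⟩
    ∑ (cartesianProduct V V) (λ (a , b) → ⟦ isEdge? G (a , b) ⟧ * (s a b + s b a))
      ≡⟨ ∑-cartesianProduct _ V V ⟩
    (∑[ a ∈ V ] ∑[ b ∈ V ] ⟦ isEdge? G (a , b) ⟧ * (s a b + s b a))
      ≡⟨ ∑-cong V (λ a → trans (∑-cong V (λ b → *-distribˡ-+ ⟦ isEdge? G (a , b) ⟧ (s a b) (s b a))) (∑-+ _ _ V)) ⟩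
    (∑[ a ∈ V ] (∑[ b ∈ V ] ⟦ isEdge? G (a , b) ⟧ * s a b) + (∑[ b ∈ V ] ⟦ isEdge? G (a , b) ⟧ * s b a))
      ≡⟨ ∑-+ _ _ V ⟩
    (∑[ a ∈ V ] ∑[ b ∈ V ] ⟦ isEdge? G (a , b) ⟧ * s a b) + (∑[ a ∈ V ] ∑[ b ∈ V ] ⟦ isEdge? G (a , b) ⟧ * s b a)
      ≡⟨ cong ((∑[ a ∈ V ] ∑[ b ∈ V ] ⟦ isEdge? G (a , b) ⟧ * s a b) +_)
           (∑-swap V V (λ a b → ⟦ isEdge? G (a , b) ⟧ * s b a)) ⟩
    (∑[ a ∈ V ] ∑[ b ∈ V ] ⟦ isEdge? G (a , b) ⟧ * s a b) + (∑[ a ∈ V ] ∑[ b ∈ V ] ⟦ isEdge? G (b , a) ⟧ * s a b)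
      ≡⟨ ∑-+ _ _ V ⟨
    (∑[ a ∈ V ] (∑[ b ∈ V ] ⟦ isEdge? G (a , b) ⟧ * s a b) + (∑[ b ∈ V ] ⟦ isEdge? G (b , a) ⟧ * s a b))
      ≡⟨ ∑-cong V (λ a → trans (sym (∑-+ _ _ V)) (∑-cong V (pointwise a))) ⟩
    (∑[ a ∈ V ] ∑[ b ∈ V ] adj a b * s a b) ∎
    where
    open ≡-Reasoning
    -- Adjacent vertices are distinct, so exactly one of the two orientations is increasing.
    orient : ∀ a b → ⟦ isEdge? G (a , b) ⟧ + ⟦ isEdge? G (b , a) ⟧ ≡ adj a b
    orient a b rewrite ⟦⟧-× (a Fin.<? b) (adj? a b) | ⟦⟧-× (b Fin.<? a) (adj? b a) | adj-comm b a
      with Fin.<-cmp a b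
    ... | tri< a<b _ b≮a rewrite dec-true (a Fin.<? b) a<b | dec-false (b Fin.<? a) b≮a =
      trans (+-identityʳ _) (*-identityˡ (adj a b))
    ... | tri> a≮b _ b<a rewrite dec-false (a Fin.<? b) a≮b | dec-true (b Fin.<? a) b<a = *-identityˡ (adj a b)
    ... | tri≈ a≮b refl _ rewrite dec-false (a Fin.<? b) a≮b | dec-false (adj? a a) (adj-irrefl refl) = refl
    pointwise : ∀ a b → ⟦ isEdge? G (a , b) ⟧ * s a b + ⟦ isEdge? G (b , a) ⟧ * s a b ≡ adj a b * s a b
    pointwise a b = trans (sym (*-distribʳ-+ (s a b) ⟦ isEdge? G (a , b) ⟧ _)) (cong (_* s a b) (orient a b))

  -- Vertices not covered by the current matching.

  vacant : List Edge → Fin n → ℕ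
  vacant []            u = 1
  vacant ((a , b) ∷ M) u = ne a u * ne b u * vacant M u

  vacant-0-or-1 : ∀ M u → vacant M u ≡ 0 ⊎ vacant M u ≡ 1
  vacant-0-or-1 []            u = inj₂ refl
  vacant-0-or-1 ((a , b) ∷ M) u = *-0-or-1
    (*-0-or-1 (0-or-1 (¬? (a Fin.≟ u))) (0-or-1 (¬? (b Fin.≟ u)))) (vacant-0-or-1 M u)

  vacant-≤1 : ∀ M u → vacant M u ≤ 1
  vacant-≤1 M u with vacant-0-or-1 M u
  ... | inj₁ eq0 = ≤-trans (≤-reflexive eq0) z≤n
  ... | inj₂ eq1 = ≤-reflexive eq1

  vacant-disjoint : ∀ M {a b} → vacant M a ≡ 1 → vacant M b ≡ 1 → All (Disjoint (a , b)) M
  vacant-disjoint []            _  _  = []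
  vacant-disjoint ((c , d) ∷ M) {a} {b} va vb =
    ((≢-sym (ne≡1⇒≢ (fst a va)) , ≢-sym (ne≡1⇒≢ (snd a va))) ,
     (≢-sym (ne≡1⇒≢ (fst b vb)) , ≢-sym (ne≡1⇒≢ (snd b vb)))) ∷
    vacant-disjoint M (m*n≡1⇒n≡1 (ne c a * ne d a) _ va) (m*n≡1⇒n≡1 (ne c b * ne d b) _ vb)
    where
    fst : ∀ u → vacant ((c , d) ∷ M) u ≡ 1 → ne c u ≡ 1
    fst u vu = m*n≡1⇒m≡1 (ne c u) (ne d u) (m*n≡1⇒m≡1 (ne c u * ne d u) _ vu)
    snd : ∀ u → vacant ((c , d) ∷ M) u ≡ 1 → ne d u ≡ 1
    snd u vu = m*n≡1⇒n≡1 (ne c u) (ne d u) (m*n≡1⇒m≡1 (ne c u * ne d u) _ vu)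

  disjoint-vacant : ∀ {M a b} → All (Disjoint (a , b)) M → vacant M a ≡ 1 × vacant M b ≡ 1
  disjoint-vacant [] = refl , refl
  disjoint-vacant (((a≢c , a≢d) , (b≢c , b≢d)) ∷ ds) with disjoint-vacant ds
  ... | va , vb = cong₂ _*_ (cong₂ _*_ (ne-≢ (≢-sym a≢c)) (ne-≢ (≢-sym a≢d))) va
                , cong₂ _*_ (cong₂ _*_ (ne-≢ (≢-sym b≢c)) (ne-≢ (≢-sym b≢d))) vb

  -- The 0-1 value that decides the greedy step: for an edge of `G` and a matching `M`, acceptance
  -- means value 1. A number rather than a predicate can serve as a weight in sums.
  free : List Edge → Edge → ℕ
  free M (a , b) = vacant M a * vacant M b

  free-matching : ∀ {M e} → IsMatching G M → IsEdge G e → free M e ≡ 1 → IsMatching G (e ∷ M)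
  free-matching {M} {a , b} (edgesM , disj) edge fe =
    edge ∷ edgesM , vacant-disjoint M (m*n≡1⇒m≡1 _ (vacant M b) fe) (m*n≡1⇒n≡1 (vacant M a) _ fe) ∷ disj

  greedyStep-free : ∀ {M e} → IsMatching G M → IsEdge G e → free M e ≡ 1 → greedyStep G M e ≡ e ∷ M
  greedyStep-free {M} {e} matching edge fe
    rewrite dec-true (isMatching? G (e ∷ M)) (free-matching matching edge fe) = refl

  greedyStep-blocked : ∀ {M e} → free M e ≡ 0 → greedyStep G M e ≡ M
  greedyStep-blocked {M} {a , b} fe =
    cong (if_then (a , b) ∷ M else M) (dec-false (isMatching? G ((a , b) ∷ M)) ¬matching)
    where
    ¬matching : ¬ IsMatching G ((a , b) ∷ M)
    ¬matching (_ , ds ∷ _) with disjoint-vacant ds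
    ... | va , vb with trans (sym fe) (cong₂ _*_ va vb)
    ...   | ()

  greedy-matching : ∀ π {M} → IsMatching G M → IsMatching G (foldl (greedyStep G) M π)
  greedy-matching []      matching = matching
  greedy-matching (e ∷ π) {M} matching =
    greedy-matching π (if-elim (IsMatching G) (isMatching? G (e ∷ M)) id matching)

  greedy-covered : ∀ π {M v} → vacant M v ≡ 0 → vacant (foldl (greedyStep G) M π) v ≡ 0
  greedy-covered []            v0 = v0
  greedy-covered ((a , b) ∷ π) {M} {v} v0 = greedy-covered π
    (if-elim (λ M′ → vacant M′ v ≡ 0) (isMatching? G ((a , b) ∷ M))
      (λ _ → trans (cong (ne a v * ne b v *_) v0) (*-zeroʳ (ne a v * ne b v))) v0)

  -- Accepting a free edge changes vacancy only at its two ends, from 1 to 0; distinctness prevents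
  -- one vertex from being counted twice.
  vacant-∷ : ∀ {M a b} → a ≢ b → free M (a , b) ≡ 1 → ∀ u →
             vacant M u ≡ vacant ((a , b) ∷ M) u + (eq a u + eq b u)
  vacant-∷ {M} {a} {b} a≢b fe u with a Fin.≟ u | b Fin.≟ u
  ... | yes refl | yes refl = contradiction refl a≢b
  ... | yes refl | no _     = m*n≡1⇒m≡1 _ (vacant M b) fe
  ... | no _     | yes refl = m*n≡1⇒n≡1 (vacant M a) _ fe
  ... | no _     | no _     = lemma (vacant M u)
    where
    lemma : ∀ x → x ≡ 1 * 1 * x + 0
    lemma = solve-∀

  edge⇒≢ : ∀ {a b} → IsEdge G (a , b) → a ≢ b
  edge⇒≢ (a<b , _) refl = Fin.<-irrefl refl a<b

  -- Each edge of a matching covers two new vertices. This reduces the size of the greedy matching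
  -- to bounds for single vertices.
  2*length+vacant : ∀ {M} → IsMatching G M → 2 * length M + ∑ V (vacant M) ≡ n
  2*length+vacant {[]} _ = trans (∑-const 1 V) (trans (*-identityʳ (length V)) (length-tabulate id))
  2*length+vacant {(a , b) ∷ M} (edge ∷ edgesM , ds ∷ disj) = begin
    2 * suc (length M) + ∑ V (vacant ((a , b) ∷ M))       ≡⟨ lemma (length M) _ ⟩
    2 * length M + (∑ V (vacant ((a , b) ∷ M)) + 2)
      ≡⟨ cong (λ t → 2 * length M + (∑ V (vacant ((a , b) ∷ M)) + t)) two ⟨
    2 * length M + (∑ V (vacant ((a , b) ∷ M)) + (∑[ u ∈ V ] eq a u + eq b u))
      ≡⟨ cong (2 * length M +_) (∑-+ _ _ V) ⟨
    2 * length M + (∑[ u ∈ V ] vacant ((a , b) ∷ M) u + (eq a u + eq b u))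
      ≡⟨ cong (2 * length M +_) (∑-cong V (vacant-∷ {M} (edge⇒≢ edge) (cong₂ _*_ va vb))) ⟨
    2 * length M + ∑ V (vacant M)                         ≡⟨ 2*length+vacant (edgesM , disj) ⟩
    n                                                     ∎
    where
    open ≡-Reasoning
    va = proj₁ (disjoint-vacant ds)
    vb = proj₂ (disjoint-vacant ds)
    one : ∀ c → ∑ V (eq c) ≡ 1
    one c = trans (sym (∑-cong V (λ u → *-identityʳ (eq c u)))) (∑-eq c (λ _ → 1))
    two : (∑[ u ∈ V ] eq a u + eq b u) ≡ 2
    two = trans (∑-+ (eq a) (eq b) V) (cong₂ _+_ (one a) (one b))
    lemma : ∀ m x → 2 * suc m + x ≡ 2 * m + (x + 2)
    lemma = solve-∀

  -- Free edges at a vertex and at its neighbours.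

  vacantNbrs : List Edge → Fin n → ℕ
  vacantNbrs M v = ∑[ u ∈ V ] adj v u * vacant M u

  -- Since `v` is vacant, an edge at `v` is free exactly when its other end is vacant.
  ∑-free-incident : ∀ M v → vacant M v ≡ 1 →
    (∑[ e ∈ edges G ] free M e * (eq v (proj₁ e) + eq v (proj₂ e))) ≡ vacantNbrs M v
  ∑-free-incident M v vacant-v = begin
    (∑[ e ∈ edges G ] free M e * (eq v (proj₁ e) + eq v (proj₂ e)))
      ≡⟨ ∑-cong (edges G) (λ (a , b) → lemma₁ (vacant M a) (vacant M b) (eq v a) (eq v b)) ⟩
    (∑[ e ∈ edges G ] s (proj₁ e) (proj₂ e) + s (proj₂ e) (proj₁ e))
      ≡⟨ ∑-edges s ⟩
    (∑[ a ∈ V ] ∑[ b ∈ V ] adj a b * s a b)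
      ≡⟨ ∑-cong V (λ a → trans (∑-cong V (λ b → lemma₂ (adj a b) (eq v a) (vacant M a) (vacant M b)))
                               (∑-*ˡ (eq v a) _ V)) ⟩
    (∑[ a ∈ V ] eq v a * (∑[ b ∈ V ] vacant M a * (adj a b * vacant M b)))
      ≡⟨ ∑-eq v (λ a → ∑[ b ∈ V ] vacant M a * (adj a b * vacant M b)) ⟩
    (∑[ b ∈ V ] vacant M v * (adj v b * vacant M b))
      ≡⟨ ∑-*ˡ (vacant M v) _ V ⟩
    vacant M v * vacantNbrs M v
      ≡⟨ trans (cong (_* vacantNbrs M v) vacant-v) (*-identityˡ _) ⟩
    vacantNbrs M v ∎
    where
    open ≡-Reasoning
    s : Fin n → Fin n → ℕ
    s a b = eq v a * (vacant M a * vacant M b)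
    lemma₁ : ∀ x y p q → x * y * (p + q) ≡ p * (x * y) + q * (y * x)
    lemma₁ = solve-∀
    lemma₂ : ∀ c p x y → c * (p * (x * y)) ≡ p * (x * (c * y))
    lemma₂ = solve-∀

  -- Each vacant neighbour a of v lies on at most d′ free edges other than va.
  ∑-free-adjacent : ∀ {d′} → Regular G (suc d′) → ∀ M v →
    (∑[ e ∈ edges G ] free M e * (adj v (proj₁ e) * ne v (proj₂ e) + adj v (proj₂ e) * ne v (proj₁ e))) ≤
    d′ * vacantNbrs M v
  ∑-free-adjacent {d′} regular M v = begin
    (∑[ e ∈ edges G ] free M e * (adj v (proj₁ e) * ne v (proj₂ e) + adj v (proj₂ e) * ne v (proj₁ e)))
      ≡⟨ ∑-cong (edges G) (λ (a , b) → lemma₁ (vacant M a) (vacant M b) (adj v a * ne v b) (adj v b * ne v a)) ⟩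
    (∑[ e ∈ edges G ] s (proj₁ e) (proj₂ e) + s (proj₂ e) (proj₁ e))
      ≡⟨ ∑-edges s ⟩
    (∑[ a ∈ V ] ∑[ b ∈ V ] adj a b * s a b)
      ≤⟨ ∑-mono V (λ {a} _ → ≤-trans (∑-mono V (λ {b} _ → drop a b)) (≤-reflexive (∑-*ˡ (vacant M a * adj v a) _ V))) ⟩
    (∑[ a ∈ V ] vacant M a * adj v a * (∑[ b ∈ V ] adj a b * ne v b))
      ≤⟨ ∑-mono V (λ {a} _ → others a) ⟩
    (∑[ a ∈ V ] d′ * (adj v a * vacant M a))
      ≡⟨ ∑-*ˡ d′ _ V ⟩
    d′ * vacantNbrs M v ∎
    where
    open ≤-Reasoning
    s : Fin n → Fin n → ℕ
    s a b = vacant M a * vacant M b * (adj v a * ne v b)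
    lemma₁ : ∀ x y p q → x * y * (p + q) ≡ x * y * p + y * x * q
    lemma₁ = solve-∀
    lemma₂ : ∀ c x y p q → c * (x * y * (p * q)) ≡ x * p * (c * q) * y
    lemma₂ = solve-∀
    -- Bounding the vacancy of `b` by 1 leaves the neighbours of `a` other than `v`, which
    -- regularity counts.
    drop : ∀ a b → adj a b * s a b ≤ vacant M a * adj v a * (adj a b * ne v b)
    drop a b = begin
      adj a b * s a b                                          ≡⟨ lemma₂ (adj a b) (vacant M a) (vacant M b) (adj v a) (ne v b) ⟩
      vacant M a * adj v a * (adj a b * ne v b) * vacant M b   ≤⟨ *-monoʳ-≤ (vacant M a * adj v a * (adj a b * ne v b)) (vacant-≤1 M b) ⟩
      vacant M a * adj v a * (adj a b * ne v b) * 1            ≡⟨ *-identityʳ _ ⟩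
      vacant M a * adj v a * (adj a b * ne v b)                ∎
    degree-split : ∀ a → (∑[ b ∈ V ] adj a b * ne v b) + adj a v ≡ suc d′
    degree-split a = begin-equality
      (∑[ b ∈ V ] adj a b * ne v b) + adj a v
        ≡⟨ cong ((∑[ b ∈ V ] adj a b * ne v b) +_) (∑-eq v (adj a)) ⟨
      (∑[ b ∈ V ] adj a b * ne v b) + (∑[ b ∈ V ] eq v b * adj a b)
        ≡⟨ ∑-+ _ _ V ⟨
      (∑[ b ∈ V ] adj a b * ne v b + eq v b * adj a b)
        ≡⟨ ∑-cong V (λ b → trans (lemma₃ (adj a b) (ne v b) (eq v b))
             (trans (cong (adj a b *_) (ne+eq v b)) (*-identityʳ (adj a b)))) ⟩
      ∑ V (adj a)     ≡⟨ ∑-adj a ⟩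
      degree G a      ≡⟨ regular a ⟩
      suc d′          ∎
      where
      lemma₃ : ∀ x p q → x * p + q * x ≡ x * (p + q)
      lemma₃ = solve-∀
    others : ∀ a → vacant M a * adj v a * (∑[ b ∈ V ] adj a b * ne v b) ≤ d′ * (adj v a * vacant M a)
    others a with 0-or-1 (adj? v a)
    ... | inj₁ va≡0 rewrite va≡0 | *-zeroʳ (vacant M a) = z≤n
    ... | inj₂ va≡1 = ≤-reflexive (begin-equality
      vacant M a * adj v a * S    ≡⟨ cong (vacant M a * adj v a *_) S≡d′ ⟩
      vacant M a * adj v a * d′   ≡⟨ lemma₃ (vacant M a) (adj v a) d′ ⟩
      d′ * (adj v a * vacant M a) ∎)
      where
      S = ∑[ b ∈ V ] adj a b * ne v b
      S≡d′ : S ≡ d′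
      S≡d′ = +-cancelʳ-≡ 1 S d′ (trans (cong (S +_) (sym (trans (adj-comm a v) va≡1)))
        (trans (degree-split a) (+-comm 1 d′)))
      lemma₃ : ∀ x y z → x * y * z ≡ z * (y * x)
      lemma₃ = solve-∀

  -- The number of covered neighbours of `v` thus grows by 0, 1 or, when the edge closes a triangle
  -- at `v`, 2.
  vacantNbrs-∷ : ∀ {M a b} → a ≢ b → free M (a , b) ≡ 1 → ∀ v →
                 vacantNbrs M v ≡ vacantNbrs ((a , b) ∷ M) v + (adj v a + adj v b)
  vacantNbrs-∷ {M} {a} {b} a≢b fe v = begin
    (∑[ u ∈ V ] adj v u * vacant M u)
      ≡⟨ ∑-cong V (λ u → trans (cong (adj v u *_) (vacant-∷ {M} a≢b fe u))
           (lemma (adj v u) (vacant ((a , b) ∷ M) u) (eq a u) (eq b u))) ⟩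
    (∑[ u ∈ V ] adj v u * vacant ((a , b) ∷ M) u + (eq a u * adj v u + eq b u * adj v u))
      ≡⟨ trans (∑-+ _ _ V) (cong (vacantNbrs ((a , b) ∷ M) v +_) (∑-+ _ _ V)) ⟩
    vacantNbrs ((a , b) ∷ M) v + ((∑[ u ∈ V ] eq a u * adj v u) + (∑[ u ∈ V ] eq b u * adj v u))
      ≡⟨ cong (vacantNbrs ((a , b) ∷ M) v +_) (cong₂ _+_ (∑-eq a (adj v)) (∑-eq b (adj v))) ⟩
    vacantNbrs ((a , b) ∷ M) v + (adj v a + adj v b) ∎
    where
    open ≡-Reasoning
    lemma : ∀ c x p q → c * (x + (p + q)) ≡ c * x + (p * c + q * c)
    lemma = solve-∀

  -- States of the process: current matching and edges yet to arrive.

  -- The free edges are those of G all of whose endpoints are vacant, and each of them has yet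
  -- to arrive; weighing edges by an arbitrary φ expresses this with multiplicities.
  record State (M R : List Edge) : Set where
    field
      matching : IsMatching G M
      isEdges  : All (IsEdge G) R
      balance  : ∀ (φ : Edge → ℕ) → (∑[ e ∈ R ] free M e * φ e) ≡ (∑[ e ∈ edges G ] free M e * φ e)

  open State

  initial : State [] (edges G)
  initial = record
    { matching = [] , [] ; isEdges = all-filter (isEdge? G) (cartesianProduct V V) ; balance = λ _ → refl }

  -- A blocked edge has weight 0 in `balance`, so its removal leaves the sum over `R` unchanged.
  blocked : ∀ {M R s} → State M R → s ∈ select R → free M (proj₁ s) ≡ 0 → State M (proj₂ s)
  blocked {M} {R} {e , R′} st s∈ fe = record
    { matching = matching st
    ; isEdges  = proj₂ (select-All s∈ (isEdges st))
    ; balance  = λ φ → trans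
        (sym (trans (select-split s∈ (λ x → free M x * φ x)) (cong (λ t → t * φ e + (∑[ x ∈ R′ ] free M x * φ x)) fe)))
        (balance st φ)
    }

  -- Enlarging `M` by `e` multiplies `free M` by `factor`, which is absorbed into the arbitrary
  -- weight φ of the old `balance`.
  accepted : ∀ {M R s} → State M R → s ∈ select R → free M (proj₁ s) ≡ 1 → State (proj₁ s ∷ M) (proj₂ s)
  accepted {M} {R} {e@(a , b) , R′} st s∈ fe = record
    { matching = free-matching (matching st) (proj₁ (select-All s∈ (isEdges st))) fe
    ; isEdges  = proj₂ (select-All s∈ (isEdges st))
    ; balance  = balance′
    }
    where
    open ≡-Reasoning
    factor : Edge → ℕ
    factor (c , d) = ne a c * ne b c * (ne a d * ne b d)
    free-∷ : ∀ φ x → free (e ∷ M) x * φ x ≡ free M x * (factor x * φ x)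
    free-∷ φ (c , d) = lemma (ne a c * ne b c) (ne a d * ne b d) (vacant M c) (vacant M d) (φ (c , d))
      where
      lemma : ∀ p q x y z → p * x * (q * y) * z ≡ x * y * (p * q * z)
      lemma = solve-∀
    -- The accepted edge blocks itself, so it may be dropped from the remaining edges.
    free-self : ∀ φ → free (e ∷ M) e * φ e ≡ 0
    free-self φ rewrite ne-refl a = refl
    balance′ : ∀ φ → (∑[ x ∈ R′ ] free (e ∷ M) x * φ x) ≡ (∑[ x ∈ edges G ] free (e ∷ M) x * φ x)
    balance′ φ = begin
      (∑[ x ∈ R′ ] free (e ∷ M) x * φ x)
        ≡⟨ trans (select-split s∈ (λ x → free (e ∷ M) x * φ x)) 
            (cong (_+ (∑[ x ∈ R′ ] free (e ∷ M) x * φ x)) (free-self φ)) ⟨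
      (∑[ x ∈ R ] free (e ∷ M) x * φ x)               ≡⟨ ∑-cong R (free-∷ φ) ⟩
      (∑[ x ∈ R ] free M x * (factor x * φ x))        ≡⟨ balance st (λ x → factor x * φ x) ⟩
      (∑[ x ∈ edges G ] free M x * (factor x * φ x))  ≡⟨ ∑-cong (edges G) (free-∷ φ) ⟨
      (∑[ x ∈ edges G ] free (e ∷ M) x * φ x)         ∎

  -- The supermartingale at a single vertex.

  module _ {d′ N} (regular : Regular G (suc d′)) (pot : Potential d′ N) (v : Fin n) where
    open Potential pot

    vacantOutcomes : List Edge → List Edge → ℕ
    vacantOutcomes M R = ∑[ π ∈ perms R ] vacant (foldl (greedyStep G) M π) v

    -- The potential after the arrival of an edge: unchanged if the edge is blocked, 0 if it matches
    -- `v`, and otherwise taken at the new number of covered neighbours.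
    cost : List Edge → ℕ → Edge → ℕ
    cost M c (a , b) =
      (1 ∸ free M (a , b)) * w c + free M (a , b) * (ne v a * ne v b * w (c + (adj v a + adj v b)))

    cost-blocked : ∀ {M} c e → free M e ≡ 0 → cost M c e ≡ w c
    cost-blocked c (a , b) fe rewrite fe = lemma (w c)
      where
      lemma : ∀ x → 1 * x + 0 ≡ x
      lemma = solve-∀

    cost-accepted : ∀ {M} c a b → free M (a , b) ≡ 1 →
                    cost M c (a , b) ≡ ne v a * ne v b * w (c + (adj v a + adj v b))
    cost-accepted c a b fe rewrite fe = +-identityʳ _

    -- A bound linear in the number of newly covered neighbours, so that it can be summed over edges
    -- by counting incidences.
    w-step : ∀ c {i j} → i ≡ 0 ⊎ i ≡ 1 → j ≡ 0 ⊎ j ≡ 1 → q * w (c + (i + j)) ≤ q * w c + p * w c * (i + j)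
    w-step c (inj₁ refl) (inj₁ refl) rewrite +-identityʳ c = m≤m+n (q * w c) _
    w-step c (inj₁ refl) (inj₂ refl) rewrite +-comm c 1 = ≤-trans (step₁ c) (≤-reflexive (lemma q p (w c)))
      where
      lemma : ∀ q p x → (q + p) * x ≡ q * x + p * x * 1
      lemma = solve-∀
    w-step c (inj₂ refl) (inj₁ refl) = w-step c (inj₁ refl) (inj₂ refl)
    w-step c (inj₂ refl) (inj₂ refl) rewrite +-comm c 2 = ≤-trans (step₂ c) (≤-reflexive (lemma q p (w c)))
      where
      lemma : ∀ q p x → (q + 2 * p) * x ≡ q * x + p * x * 2
      lemma = solve-∀

    -- The factors `ne` keep edges at `v` out of `adjacent`: such an edge covers a neighbour, but it
    -- matches `v` as well.
    incident adjacent : Edge → ℕ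
    incident (a , b) = eq v a + eq v b
    adjacent (a , b) = adj v a * ne v b + adj v b * ne v a

    -- A free edge at `v` saves the whole potential; any other free edge raises it by at most p/q of
    -- its value per neighbour covered. The saving stands on the left to avoid subtraction.
    cost-bound : ∀ {M} c e → IsEdge G e →
      q * cost M c e + q * w c * (free M e * incident e) ≤ q * w c + p * w c * (free M e * adjacent e)
    cost-bound {M} c (a , b) edge with *-0-or-1 (vacant-0-or-1 M a) (vacant-0-or-1 M b)
    ... | inj₁ fe rewrite fe = ≤-trans (≤-reflexive (lemma q (w c))) (m≤m+n (q * w c) _)
      where
      lemma : ∀ q x → q * (1 * x + 0) + q * x * 0 ≡ q * x
      lemma = solve-∀
    ... | inj₂ fe rewrite fe = ≤-trans (≤-reflexive (lemma q _ (w c) (incident (a , b))))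
                                 (≤-trans main (≤-reflexive (lemma′ (q * w c) (p * w c) (adjacent (a , b)))))
      where
      lemma : ∀ q y x i → q * (0 * x + 1 * y) + q * x * (1 * i) ≡ q * y + q * x * i
      lemma = solve-∀
      lemma′ : ∀ x y z → x + y * z ≡ x + y * (1 * z)
      lemma′ = solve-∀
      main : q * (ne v a * ne v b * w (c + (adj v a + adj v b))) + q * w c * incident (a , b) ≤
             q * w c + p * w c * adjacent (a , b)
      main with v Fin.≟ a | v Fin.≟ b
      ... | yes refl | yes refl = contradiction refl (edge⇒≢ edge)
      ... | yes _    | no _     = ≤-trans (≤-reflexive (lemma₁ q (w c))) (m≤m+n (q * w c) _)
        where
        lemma₁ : ∀ q x → q * 0 + q * x * (1 + 0) ≡ q * x
        lemma₁ = solve-∀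
      ... | no _     | yes _    = ≤-trans (≤-reflexive (lemma₁ q (w c))) (m≤m+n (q * w c) _)
        where
        lemma₁ : ∀ q x → q * 0 + q * x * 1 ≡ q * x
        lemma₁ = solve-∀
      ... | no _     | no _     = begin
        q * (1 * w (c + (adj v a + adj v b))) + q * w c * 0   ≡⟨ lemma₁ q (w (c + (adj v a + adj v b))) (w c) ⟩
        q * w (c + (adj v a + adj v b))                       ≤⟨ w-step c (0-or-1 (adj? v a)) (0-or-1 (adj? v b)) ⟩
        q * w c + p * w c * (adj v a + adj v b)               ≡⟨ lemma₂ (q * w c) (p * w c) (adj v a) (adj v b) ⟩
        q * w c + p * w c * (adj v a * 1 + adj v b * 1)       ∎
        where
        open ≤-Reasoning
        lemma₁ : ∀ q y x → q * (1 * y) + q * x * 0 ≡ q * y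
        lemma₁ = solve-∀
        lemma₂ : ∀ x y i j → x + y * (i + j) ≡ x + y * (i * 1 + j * 1)
        lemma₂ = solve-∀

    -- The supermartingale inequality, as an average over the next edge. By `balance` the sums range
    -- over all edges of `G`: with k vacant neighbours, the saving is `q * w c * k` and the increase
    -- at most `p * w c * (d′ * k)`, which `ratio` compares.
    ∑-cost : ∀ {M R} → State M R → ∀ c → vacant M v ≡ 1 → ∑ R (cost M c) ≤ length R * w c
    ∑-cost {M} {R} st c vacant-v = *-cancelˡ-≤ q (+-cancelʳ-≤ (q * w c * k) _ _ (begin
      q * ∑ R (cost M c) + q * w c * k
        ≡⟨ cong₂ _+_ (∑-*ˡ q (cost M c) R)
             (trans (∑-*ˡ (q * w c) _ R)
               (cong (q * w c *_) (trans (balance st incident) (∑-free-incident M v vacant-v)))) ⟨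
      (∑[ e ∈ R ] q * cost M c e) + (∑[ e ∈ R ] q * w c * (free M e * incident e))
        ≡⟨ ∑-+ _ _ R ⟨
      (∑[ e ∈ R ] q * cost M c e + q * w c * (free M e * incident e))
        ≤⟨ ∑-mono R (λ {e} e∈ → cost-bound {M} c e (All.lookup (isEdges st) e∈)) ⟩
      (∑[ e ∈ R ] q * w c + p * w c * (free M e * adjacent e))
        ≡⟨ trans (∑-+ _ _ R) (cong₂ _+_ (∑-const (q * w c) R)
             (trans (∑-*ˡ (p * w c) _ R) (cong (p * w c *_) (balance st adjacent)))) ⟩
      length R * (q * w c) + p * w c * (∑[ e ∈ edges G ] free M e * adjacent e)
        ≤⟨ +-monoʳ-≤ (length R * (q * w c)) (*-monoʳ-≤ (p * w c) (∑-free-adjacent regular M v)) ⟩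
      length R * (q * w c) + p * w c * (d′ * k)
        ≡⟨ lemma₁ (length R) q (w c) p d′ k ⟩
      q * (length R * w c) + p * d′ * (w c * k)
        ≤⟨ +-monoʳ-≤ (q * (length R * w c)) (*-monoˡ-≤ (w c * k) ratio) ⟩
      q * (length R * w c) + q * (w c * k)
        ≡⟨ cong (q * (length R * w c) +_) (sym (*-assoc q (w c) k)) ⟩
      q * (length R * w c) + q * w c * k ∎))
      where
      open ≤-Reasoning
      k = vacantNbrs M v
      lemma₁ : ∀ r q x p d k → r * (q * x) + p * x * (d * k) ≡ q * (r * x) + p * d * (x * k)
      lemma₁ = solve-∀

    -- Induction over the remaining arrivals: from a state with c covered neighbours, `v` stays
    -- vacant with probability at most w(c)/w(d), where d = d′ + 1. Blocked edges keep c, edges at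
    -- `v` leave no outcomes, and other accepted edges raise c.
    vacantOutcomes-bound : ∀ r {M R} → length R ≡ r → State M R → ∀ c → vacant M v ≡ 1 →
      c + vacantNbrs M v ≡ suc d′ → w (suc d′) * vacantOutcomes M R ≤ r ! * w c
    vacantOutcomes-bound zero {M} {[]} _ st c vacant-v split = ≤-reflexive (begin
      w (suc d′) * (vacant M v + 0)  ≡⟨ cong (λ t → w (suc d′) * (t + 0)) vacant-v ⟩
      w (suc d′) * 1                 ≡⟨ *-comm (w (suc d′)) 1 ⟩
      1 * w (suc d′)                 ≡⟨ cong (λ t → 1 * w t) (trans (sym split) (trans (cong (c +_) k≡0) (+-identityʳ c))) ⟩
      1 * w c                        ∎)
      where
      open ≡-Reasoning
      -- No edge remains, so `balance` rules out free edges at `v`: all d neighbours are covered and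
      -- c = d.
      k≡0 : vacantNbrs M v ≡ 0
      k≡0 = trans (sym (∑-free-incident M v vacant-v)) (sym (balance st incident))
    vacantOutcomes-bound (suc r) {M} {R@(x ∷ xs)} len st c vacant-v split = begin
      w (suc d′) * vacantOutcomes M R
        ≡⟨ cong (w (suc d′) *_) (∑-perms x xs _) ⟩
      w (suc d′) * (∑[ s ∈ select R ] vacantOutcomes (greedyStep G M (proj₁ s)) (proj₂ s))
        ≡⟨ ∑-*ˡ (w (suc d′)) _ (select R) ⟨
      (∑[ s ∈ select R ] w (suc d′) * vacantOutcomes (greedyStep G M (proj₁ s)) (proj₂ s))
        ≤⟨ ∑-mono (select R) next ⟩
      (∑[ s ∈ select R ] r ! * cost M c (proj₁ s))
        ≡⟨ trans (∑-select _ R) (∑-*ˡ (r !) (cost M c) R) ⟩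
      r ! * ∑ R (cost M c)
        ≤⟨ *-monoʳ-≤ (r !) (∑-cost st c vacant-v) ⟩
      r ! * (length R * w c)
        ≡⟨ cong (λ t → r ! * (t * w c)) len ⟩
      r ! * (suc r * w c)
        ≡⟨ lemma (r !) (suc r) (w c) ⟩
      suc r ! * w c ∎
      where
      open ≤-Reasoning
      lemma : ∀ x y z → x * (y * z) ≡ y * x * z
      lemma = solve-∀
      next : ∀ {s} → s ∈ select R →
             w (suc d′) * vacantOutcomes (greedyStep G M (proj₁ s)) (proj₂ s) ≤ r ! * cost M c (proj₁ s)
      next {e@(a , b) , R′} s∈ with *-0-or-1 (vacant-0-or-1 M a) (vacant-0-or-1 M b)
      ... | inj₁ fe = begin
        w (suc d′) * vacantOutcomes (greedyStep G M e) R′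
          ≡⟨ cong (λ M′ → w (suc d′) * vacantOutcomes M′ R′) (greedyStep-blocked {M} {e} fe) ⟩
        w (suc d′) * vacantOutcomes M R′
          ≤⟨ vacantOutcomes-bound r (suc-injective (trans (sym (select-length s∈)) len)) (blocked st s∈ fe)
               c vacant-v split ⟩
        r ! * w c              ≡⟨ cong (r ! *_) (cost-blocked {M} c e fe) ⟨
        r ! * cost M c e       ∎
      ... | inj₂ fe = begin
        w (suc d′) * vacantOutcomes (greedyStep G M e) R′
          ≡⟨ cong (λ M′ → w (suc d′) * vacantOutcomes M′ R′) (greedyStep-free (matching st) edge fe) ⟩
        w (suc d′) * vacantOutcomes (e ∷ M) R′
          ≤⟨ main ⟩
        r ! * (ne v a * ne v b * w (c + (adj v a + adj v b)))
          ≡⟨ cong (r ! *_) (cost-accepted {M} c a b fe) ⟨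
        r ! * cost M c e       ∎
        where
        edge = proj₁ (select-All s∈ (isEdges st))
        no-outcomes : vacant (e ∷ M) v ≡ 0 → vacantOutcomes (e ∷ M) R′ ≡ 0
        no-outcomes v0 = trans (∑-cong (perms R′) λ π → greedy-covered π {e ∷ M} v0)
          (trans (∑-const 0 (perms R′)) (*-zeroʳ (length (perms R′))))
        covered : ∀ {t} → vacant (e ∷ M) v ≡ 0 → w (suc d′) * vacantOutcomes (e ∷ M) R′ ≤ t
        covered v0 = ≤-trans (≤-reflexive (trans (cong (w (suc d′) *_) (no-outcomes v0)) (*-zeroʳ (w (suc d′))))) z≤n
        main : w (suc d′) * vacantOutcomes (e ∷ M) R′ ≤ r ! * (ne v a * ne v b * w (c + (adj v a + adj v b)))
        main with v Fin.≟ a | v Fin.≟ b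
        ... | yes refl | _ = covered (cong (λ t → t * ne b v * vacant M v) (ne-refl v))
        ... | no _ | yes refl =
          covered (cong (_* vacant M v) (trans (cong (ne a v *_) (ne-refl v)) (*-zeroʳ (ne a v))))
        ... | no v≢a | no v≢b = ≤-trans
          (vacantOutcomes-bound r (suc-injective (trans (sym (select-length s∈)) len)) (accepted st s∈ fe)
            (c + (adj v a + adj v b))
            (cong₂ _*_ (cong₂ _*_ (ne-≢ (≢-sym v≢a)) (ne-≢ (≢-sym v≢b))) vacant-v)
            (trans (lemma₂ c (adj v a + adj v b) _)
              (trans (cong (c +_) (sym (vacantNbrs-∷ {M} (edge⇒≢ edge) fe v))) split)))
          (≤-reflexive (cong (r ! *_) (sym (+-identityʳ (w (c + (adj v a + adj v b)))))))
          where
          lemma₂ : ∀ x y z → x + y + z ≡ x + (z + y)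
          lemma₂ = solve-∀

    -- The process starts at c = 0, and `growth` bounds w(0)/w(d) by the reciprocal of the N-th
    -- partial sum of e; this therefore bounds the probability that `v` stays unmatched.
    expNumerator-vacant : expNumerator N * vacantOutcomes [] (edges G) ≤ length (edges G) ! * N !
    expNumerator-vacant = *-cancelʳ-≤ _ _ (w 0) (begin
      expNumerator N * U * w 0     ≡⟨ lemma (expNumerator N) U (w 0) ⟩
      expNumerator N * w 0 * U     ≤⟨ *-monoˡ-≤ U growth ⟩
      N ! * w (suc d′) * U         ≡⟨ *-assoc (N !) (w (suc d′)) U ⟩
      N ! * (w (suc d′) * U)       ≤⟨ *-monoʳ-≤ (N !) (vacantOutcomes-bound m refl initial 0 refl
                                        (trans (∑-cong V λ u → *-identityʳ (adj v u)) (trans (∑-adj v) (regular v)))) ⟩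
      N ! * (m ! * w 0)            ≡⟨ lemma′ (N !) (m !) (w 0) ⟩
      m ! * N ! * w 0              ∎)
      where
      open ≤-Reasoning
      m = length (edges G)
      U = vacantOutcomes [] (edges G)
      lemma : ∀ x y z → x * y * z ≡ x * z * y
      lemma = solve-∀
      lemma′ : ∀ x y z → x * (y * z) ≡ y * x * z
      lemma′ = solve-∀

  -- From single vertices to the size of the matching.

  totalSize : ℕ
  totalSize = ∑[ π ∈ perms (edges G) ] length (greedy G π)

  matching-≤ : ∀ {M} → IsMatching G M → 2 * length M ≤ n
  matching-≤ {M} matching = subst (2 * length M ≤_) (2*length+vacant matching) (m≤m+n (2 * length M) _)

  -- In each ordering, twice the greedy size plus the number of unmatched vertices is n. Summing the
  -- vertex bounds gives a mean size of at least (n/2)(1 - N!/X), while `M` has at most n/2 edges.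
  greedy-ratio : ∀ {d′} → Regular G (suc d′) → ∀ N M → IsMatching G M →
    expNumerator N * length M * length (edges G) ! ≤
    expNumerator N * totalSize + N ! * length M * length (edges G) !
  greedy-ratio {d′} regular N M matching = *-cancelˡ-≤ 2 (+-cancelʳ-≤ (X * (δ * m !)) _ _ (begin
    2 * (X * o * m !) + X * (δ * m !)               ≡⟨ lemma₁ X o (m !) δ ⟩
    X * ((2 * o + δ) * m !)                         ≡⟨ cong (X *_) (cong (_* m !) o+δ) ⟩
    X * (n * m !)                                   ≡⟨ cong (X *_) total ⟨
    X * (2 * totalSize + (∑[ v ∈ V ] U v))          ≡⟨ *-distribˡ-+ X (2 * totalSize) _ ⟩
    X * (2 * totalSize) + X * (∑[ v ∈ V ] U v)      ≤⟨ +-monoʳ-≤ (X * (2 * totalSize)) unmatched ⟩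
    X * (2 * totalSize) + n * (m ! * N !)           ≡⟨ cong (λ t → X * (2 * totalSize) + t * (m ! * N !)) o+δ ⟨
    X * (2 * totalSize) + (2 * o + δ) * (m ! * N !) ≡⟨ lemma₂ X totalSize o δ (m !) (N !) ⟩
    2 * (X * totalSize + N ! * o * m !) + N ! * (δ * m !)
      -- The δ vertices missed by `M` are absorbed because 1 - N!/X is nonnegative.
      ≤⟨ +-monoʳ-≤ (2 * (X * totalSize + N ! * o * m !)) (*-monoˡ-≤ (δ * m !) (n!≤expNumerator N)) ⟩
    2 * (X * totalSize + N ! * o * m !) + X * (δ * m !) ∎))
    where
    open ≤-Reasoning
    X = expNumerator N
    m = length (edges G)
    o = length M
    δ = n ∸ 2 * o
    U : Fin n → ℕ
    U v = ∑[ π ∈ perms (edges G) ] vacant (greedy G π) v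
    o+δ : 2 * o + δ ≡ n
    o+δ = m+[n∸m]≡n (matching-≤ matching)
    n!≤expNumerator : ∀ N → N ! ≤ expNumerator N
    n!≤expNumerator zero    = ≤-refl
    n!≤expNumerator (suc N) = ≤-trans (*-mono-≤ (≤-reflexive (sym (*-identityʳ (suc N)))) (n!≤expNumerator N)) (m≤m+n _ _)
    total : 2 * totalSize + (∑[ v ∈ V ] U v) ≡ n * m !
    total = begin-equality
      2 * totalSize + (∑[ v ∈ V ] U v)
        ≡⟨ cong₂ _+_ (sym (∑-*ˡ 2 (length ∘ greedy G) (perms (edges G))))
             (∑-swap V (perms (edges G)) (λ v π → vacant (greedy G π) v)) ⟩
      (∑[ π ∈ perms (edges G) ] 2 * length (greedy G π)) + (∑[ π ∈ perms (edges G) ] ∑ V (vacant (greedy G π)))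
        ≡⟨ ∑-+ (λ π → 2 * length (greedy G π)) (λ π → ∑ V (vacant (greedy G π))) (perms (edges G)) ⟨
      (∑[ π ∈ perms (edges G) ] 2 * length (greedy G π) + ∑ V (vacant (greedy G π)))
        ≡⟨ ∑-cong (perms (edges G)) (λ π → 2*length+vacant (greedy-matching π ([] , []))) ⟩
      (∑[ π ∈ perms (edges G) ] n)     ≡⟨ ∑-const n (perms (edges G)) ⟩
      length (perms (edges G)) * n     ≡⟨ cong (_* n) (length-perms m (edges G) refl) ⟩
      m ! * n                          ≡⟨ *-comm (m !) n ⟩
      n * m !                          ∎
    unmatched : X * (∑[ v ∈ V ] U v) ≤ n * (m ! * N !)
    unmatched = begin
      X * (∑[ v ∈ V ] U v)             ≡⟨ ∑-*ˡ X U V ⟨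
      (∑[ v ∈ V ] X * U v)             ≤⟨ ∑-mono V (λ {v} _ → expNumerator-vacant regular (potential d′ N) v) ⟩
      (∑[ v ∈ V ] m ! * N !)           ≡⟨ ∑-const (m ! * N !) V ⟩
      length V * (m ! * N !)           ≡⟨ cong (_* (m ! * N !)) (length-tabulate {n = n} id) ⟩
      n * (m ! * N !)                  ∎
    lemma₁ : ∀ x o l δ → 2 * (x * o * l) + x * (δ * l) ≡ x * ((2 * o + δ) * l)
    lemma₁ = solve-∀
    lemma₂ : ∀ x s o δ l f → x * (2 * s) + (2 * o + δ) * (l * f) ≡ 2 * (x * s + f * o * l) + f * (δ * l)
    lemma₂ = solve-∀

-- Natural numbers, expectations and partial sums of e in ℚ.

ℕ⇒ℚ : ℕ → ℚ
ℕ⇒ℚ k = ℤ.+ k ℚ./ 1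

-- Rational division reduces to lowest terms; passing to unnormalised fractions replaces this by
-- cross-multiplication.
toℚᵘ-/ : ∀ a b .{{_ : NonZero b}} → ℚ.toℚᵘ (ℤ.+ a ℚ./ b) ℚᵘ.≃ (ℤ.+ a ℚᵘ./ b)
toℚᵘ-/ a (suc b) = ℚ.toℚᵘ-fromℚᵘ (ℚᵘ.mkℚᵘ (ℤ.+ a) b)

ℕ⇒ℚ-+ : ∀ a b → ℕ⇒ℚ (a + b) ≡ ℕ⇒ℚ a ℚ.+ ℕ⇒ℚ b
ℕ⇒ℚ-+ a b = ℚ.toℚᵘ-injective (ℚᵘ.≃-trans (toℚᵘ-/ (a + b) 1) (ℚᵘ.≃-trans
  (ℚᵘ.*≡* {q = (ℤ.+ a ℚᵘ./ 1) ℚᵘ.+ (ℤ.+ b ℚᵘ./ 1)} (cong (ℤ._* ℤ.+ 1)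
    (cong₂ ℤ._+_ (sym (ℤ.*-identityʳ (ℤ.+ a))) (sym (ℤ.*-identityʳ (ℤ.+ b))))))
  (ℚᵘ.≃-sym (ℚᵘ.≃-trans (ℚ.toℚᵘ-homo-+ (ℕ⇒ℚ a) (ℕ⇒ℚ b)) (ℚᵘ.+-cong (toℚᵘ-/ a 1) (toℚᵘ-/ b 1))))))

ℕ⇒ℚ-* : ∀ a b → ℕ⇒ℚ (a * b) ≡ ℕ⇒ℚ a ℚ.* ℕ⇒ℚ b
ℕ⇒ℚ-* a b = ℚ.toℚᵘ-injective (ℚᵘ.≃-trans (toℚᵘ-/ (a * b) 1) (ℚᵘ.≃-trans
  (ℚᵘ.*≡* {q = (ℤ.+ a ℚᵘ./ 1) ℚᵘ.* (ℤ.+ b ℚᵘ./ 1)} (cong (ℤ._* ℤ.+ 1) (ℤ.pos-* a b)))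
  (ℚᵘ.≃-sym (ℚᵘ.≃-trans (ℚ.toℚᵘ-homo-* (ℕ⇒ℚ a) (ℕ⇒ℚ b)) (ℚᵘ.*-cong (toℚᵘ-/ a 1) (toℚᵘ-/ b 1))))))

/-*-cancel : ∀ a b .{{_ : NonZero b}} → (ℤ.+ a ℚ./ b) ℚ.* ℕ⇒ℚ b ≡ ℕ⇒ℚ a
/-*-cancel a b@(suc _) = ℚ.toℚᵘ-injective (ℚᵘ.≃-trans (ℚ.toℚᵘ-homo-* (ℤ.+ a ℚ./ b) (ℕ⇒ℚ b)) (ℚᵘ.≃-trans
  (ℚᵘ.*-cong (toℚᵘ-/ a b) (toℚᵘ-/ b 1))
  (ℚᵘ.≃-trans (ℚᵘ.*≡* {p = (ℤ.+ a ℚᵘ./ b) ℚᵘ.* (ℤ.+ b ℚᵘ./ 1)} {q = ℤ.+ a ℚᵘ./ 1}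
      (trans (ℤ.*-identityʳ (ℤ.+ a ℤ.* ℤ.+ b)) (cong (λ z → ℤ.+ a ℤ.* ℤ.+ z) (sym (*-identityʳ b)))))
    (ℚᵘ.≃-sym (toℚᵘ-/ a 1)))))

ℕ⇒ℚ-mono-≤ : ∀ {a b} → a ≤ b → ℕ⇒ℚ a ℚ.≤ ℕ⇒ℚ b
ℕ⇒ℚ-mono-≤ {a} {b} a≤b = ℚ.toℚᵘ-cancel-≤
  (ℚᵘ.≤-respˡ-≃ (ℚᵘ.≃-sym (toℚᵘ-/ a 1)) (ℚᵘ.≤-respʳ-≃ (ℚᵘ.≃-sym (toℚᵘ-/ b 1))
    (ℚᵘ.*≤* (ℤ.*-monoʳ-≤-nonNeg (ℤ.+ 1) (ℤ.+≤+ a≤b)))))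

ℕ⇒ℚ-positive : ∀ k .{{_ : NonZero k}} → ℚ.Positive (ℕ⇒ℚ k)
ℕ⇒ℚ-positive k@(suc _) = ℚ.normalize-pos k 1

𝔼-sum : ∀ (xs : List⁺ A) f → 𝔼 xs f ℚ.* ℕ⇒ℚ (length (toList xs)) ≡ ℕ⇒ℚ (∑ (toList xs) f)
𝔼-sum (x List⁺.∷ xs) f = /-*-cancel (∑ (x ∷ xs) f) (suc (length xs))

-- Multiplying by (N+1)! turns the newest term of the partial sum into 1, which is the recursion of
-- `expNumerator`.
e-seq-numerator : ∀ N → e-seq N ℚ.* ℕ⇒ℚ (N !) ≡ ℕ⇒ℚ (expNumerator N)
e-seq-numerator zero    = refl
e-seq-numerator (suc N) = begin
  (e-seq N ℚ.+ invFact (suc N)) ℚ.* ℕ⇒ℚ (suc N !)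
    ≡⟨ ℚ.*-distribʳ-+ (ℕ⇒ℚ (suc N !)) (e-seq N) (invFact (suc N)) ⟩
  e-seq N ℚ.* ℕ⇒ℚ (suc N !) ℚ.+ invFact (suc N) ℚ.* ℕ⇒ℚ (suc N !)
    ≡⟨ cong₂ ℚ._+_ (cong (e-seq N ℚ.*_) (ℕ⇒ℚ-* (suc N) (N !))) (/-*-cancel 1 (suc N !) {{suc N !≢0}}) ⟩
  e-seq N ℚ.* (ℕ⇒ℚ (suc N) ℚ.* ℕ⇒ℚ (N !)) ℚ.+ ℕ⇒ℚ 1
    ≡⟨ cong (ℚ._+ ℕ⇒ℚ 1) (solve 3 (λ e k f → e :* (k :* f) := k :* (e :* f)) refl (e-seq N) (ℕ⇒ℚ (suc N)) (ℕ⇒ℚ (N !))) ⟩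
  ℕ⇒ℚ (suc N) ℚ.* (e-seq N ℚ.* ℕ⇒ℚ (N !)) ℚ.+ ℕ⇒ℚ 1
    ≡⟨ cong (λ t → ℕ⇒ℚ (suc N) ℚ.* t ℚ.+ ℕ⇒ℚ 1) (e-seq-numerator N) ⟩
  ℕ⇒ℚ (suc N) ℚ.* ℕ⇒ℚ (expNumerator N) ℚ.+ ℕ⇒ℚ 1
    ≡⟨ trans (ℕ⇒ℚ-+ (suc N * expNumerator N) 1) (cong (ℚ._+ ℕ⇒ℚ 1) (ℕ⇒ℚ-* (suc N) (expNumerator N))) ⟨
  ℕ⇒ℚ (suc N * expNumerator N + 1)
    ≡⟨ cong ℕ⇒ℚ (cong₂ (λ s t → s * expNumerator N + t) (*-identityʳ (suc N)) (^-zeroˡ (suc N))) ⟨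
  ℕ⇒ℚ (expNumerator (suc N)) ∎
  where open ≡-Reasoning

-- This is `greedy-ratio` divided by N! m!: the factor N! turns numerators into partial sums of e,
-- and m! is the number of orderings.
expected-ratio : ∀ {n d′} (G : Graph n) → Regular G (suc d′) → ∀ N M → IsMatching G M →
  e-seq N ℚ.* ℕ⇒ℚ (length M) ℚ.≤ e-seq N ℚ.* expectedGreedySize G ℚ.+ ℕ⇒ℚ (length M)
expected-ratio G regular N M matching =
  ℚ.*-cancelʳ-≤-pos (ℕ⇒ℚ (N ! * m !)) {{ℕ⇒ℚ-positive (N ! * m !) {{m*n≢0 (N !) (m !) {{N !≢0}} {{m !≢0}}}}}} (begin
    E ℚ.* o ℚ.* ℕ⇒ℚ (N ! * m !)
      ≡⟨ cong (E ℚ.* o ℚ.*_) (ℕ⇒ℚ-* (N !) (m !)) ⟩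
    E ℚ.* o ℚ.* (f ℚ.* l)
      ≡⟨ solve 4 (λ E o f l → E :* o :* (f :* l) := E :* f :* o :* l) refl E o f l ⟩
    E ℚ.* f ℚ.* o ℚ.* l
      ≡⟨ cong (λ t → t ℚ.* o ℚ.* l) (e-seq-numerator N) ⟩
    ℕ⇒ℚ (expNumerator N) ℚ.* o ℚ.* l
      ≡⟨ trans (ℕ⇒ℚ-* (expNumerator N * length M) (m !)) (cong (ℚ._* l) (ℕ⇒ℚ-* (expNumerator N) (length M))) ⟨
    ℕ⇒ℚ (expNumerator N * length M * m !)
      ≤⟨ ℕ⇒ℚ-mono-≤ (greedy-ratio G regular N M matching) ⟩
    ℕ⇒ℚ (expNumerator N * totalSize G + N ! * length M * m !)
      ≡⟨ ℕ⇒ℚ-+ (expNumerator N * totalSize G) _ ⟩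
    ℕ⇒ℚ (expNumerator N * totalSize G) ℚ.+ ℕ⇒ℚ (N ! * length M * m !)
      ≡⟨ cong₂ ℚ._+_ (ℕ⇒ℚ-* (expNumerator N) (totalSize G))
           (trans (ℕ⇒ℚ-* (N ! * length M) (m !)) (cong (ℚ._* l) (ℕ⇒ℚ-* (N !) (length M)))) ⟩
    ℕ⇒ℚ (expNumerator N) ℚ.* ℕ⇒ℚ (totalSize G) ℚ.+ f ℚ.* o ℚ.* l
      ≡⟨ cong₂ (λ s t → s ℚ.* t ℚ.+ f ℚ.* o ℚ.* l) (e-seq-numerator N) expected ⟨
    E ℚ.* f ℚ.* (g ℚ.* l) ℚ.+ f ℚ.* o ℚ.* l
      ≡⟨ solve 5 (λ E f g l o → E :* f :* (g :* l) :+ f :* o :* l := (E :* g :+ o) :* (f :* l)) refl E f g l o ⟩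
    (E ℚ.* g ℚ.+ o) ℚ.* (f ℚ.* l)
      ≡⟨ cong ((E ℚ.* g ℚ.+ o) ℚ.*_) (ℕ⇒ℚ-* (N !) (m !)) ⟨
    (E ℚ.* g ℚ.+ o) ℚ.* ℕ⇒ℚ (N ! * m !) ∎)
  where
  open ℚ.≤-Reasoning
  m = length (edges G)
  E = e-seq N
  o = ℕ⇒ℚ (length M)
  f = ℕ⇒ℚ (N !)
  l = ℕ⇒ℚ (m !)
  g = expectedGreedySize G
  expected : g ℚ.* l ≡ ℕ⇒ℚ (totalSize G)
  expected = trans (cong (λ t → g ℚ.* ℕ⇒ℚ t) (sym (length-perms m (edges G) refl)))
    (𝔼-sum (permutations (edges G)) (λ π → length (greedy G π)))

-- Multiplying the bound by the reciprocal `i` of `E` isolates `g`.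
1-inverse-* : ∀ E i o g → E ℚ.* i ≡ ℚ.1ℚ → ℚ.0ℚ ℚ.≤ i →
              E ℚ.* o ℚ.≤ E ℚ.* g ℚ.+ o → (ℚ.1ℚ ℚ.- i) ℚ.* o ℚ.≤ g
1-inverse-* E i o g E*i≡1 0≤i bound = begin
  (ℚ.1ℚ ℚ.- i) ℚ.* o                       ≡⟨ cong (λ t → (t ℚ.- i) ℚ.* o) E*i≡1 ⟨
  (E ℚ.* i ℚ.- i) ℚ.* o                    ≡⟨ solve 3 (λ E i o → (E :* i :- i) :* o := i :* (E :* o) :- i :* o) refl E i o ⟩
  i ℚ.* (E ℚ.* o) ℚ.- i ℚ.* o              ≤⟨ ℚ.+-monoˡ-≤ (ℚ.- (i ℚ.* o)) (ℚ.*-monoˡ-≤-nonNeg i {{ℚ.nonNegative 0≤i}} bound) ⟩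
  i ℚ.* (E ℚ.* g ℚ.+ o) ℚ.- i ℚ.* o        ≡⟨ solve 4 (λ E i o g → i :* (E :* g :+ o) :- i :* o := E :* i :* g) refl E i o g ⟩
  E ℚ.* i ℚ.* g                            ≡⟨ cong (ℚ._* g) E*i≡1 ⟩
  ℚ.1ℚ ℚ.* g                               ≡⟨ ℚ.*-identityˡ g ⟩
  g                                        ∎
  where open ℚ.≤-Reasoning

-- The inequality between real numbers.

theorem6 : ∀ {n} (d : ℕ) → 1 ≤ d → (G : Graph n) → Regular G d →
    ∀ OPT → IsMaximumMatching G OPT →
    (1ℝ -ℝ 1/ℝ e) *ℝ fromℕ (length OPT) ≤ℝ fromℚ (expectedGreedySize G)
-- The rational inequality holds for every partial sum, so the threshold 0 serves each ε. The
-- positivity witness of `e` begins at index 0, hence the N-th term of its inverse is the reciprocal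
-- of `e-seq N`, without a shift.
theorem6 (suc d′) _ G regular OPT (matching , _) ε ε>0 = 0 , λ N _ →
  let 0<E = ℚ.<-≤-trans (ℚ.positive⁻¹ ℚ.1ℚ) (proj₂ (proj₂ (proj₂ e-positive)) N z≤n)
      instance
        E>0 = ℚ.positive 0<E
        E≢0 = ℚ.pos⇒nonZero (e-seq N)
  in ℚ.≤-trans
    (1-inverse-* (e-seq N) (ℚ.1/ e-seq N) (ℕ⇒ℚ (length OPT)) (expectedGreedySize G)
      (ℚ.*-inverseʳ (e-seq N))
      (ℚ.<⇒≤ (ℚ.positive⁻¹ (ℚ.1/ e-seq N) {{ℚ.1/pos⇒pos (e-seq N)}}))
      (expected-ratio G regular N OPT matching))
    (ℚ.≤-trans (ℚ.≤-reflexive (sym (ℚ.+-identityʳ (expectedGreedySize G))))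
      (ℚ.+-monoʳ-≤ (expectedGreedySize G) (ℚ.<⇒≤ (ℚ.positive⁻¹ ε {{ε>0}}))))
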